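{- Let $m>n$ be positive integers and let $G[V_1,V_2]$ be a balanced bipartite graph with $|V_1|=|V_2|=m+n-1$ (so $G$ has $2(m+n-1)$ vertices) and minimum degree $\delta(G)>\frac{3}{4}(m+n-1)$. Then $G\longrightarrow(CM_m, CM_n)$, i.e., for every red-blue-edge-coloring of $G$, either there is a red connected $m$-matching or there is a blue connected $n$-matching.
   Context: For a red-blue-edge-colored graph $G$, let $G_R$ (resp. $G_B$) be the spanning subgraph consisting of all red (resp. blue) edges. A red (resp. blue) component is a connected component of $G_R$ (resp. $G_B$). A red connected $k$-matching is a set of $k$ pairwise disjoint red edges all lying in a single red component; a blue connected $k$-matching is defined analogously. The notation $G\longrightarrow(CM_m,CM_n)$ means every red-blue-edge-coloring of $G$ contains a red connected $m$-matching or a blue connected $n$-matching. -}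

module Defs where

open import Data.Nat using (ℕ; zero; suc; _+_; _*_; _∸_; _<_)
open import Data.Fin using (Fin)
open import Data.Bool using (Bool; true; false; T)
open import Data.Sum using (_⊎_; inj₁; inj₂)
open import Data.Product using (_×_; _,_; Σ)
open import Data.List using (List; length; filter)
open import Data.List.Base using (allFin)
open import Data.Fin.Properties using (_≟_)
open import Relation.Binary.PropositionalEquality using (_≡_)
open import Relation.Nullary using (Dec; yes; no)
open import Data.Bool.Properties using (T?)
open import Function.Definitions using (Injective)
open import Relation.Binary.PropositionalEquality using (_≡_)

-- A bipartite graph G[V₁,V₂] with |V₁| = |V₂| = N : V₁ = V₂ = Fin N,
-- and edges only between V₁ and V₂, given by a Boolean adjacency matrix.
BipGraph : ℕ → Set
BipGraph N = Fin N → Fin N → Bool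

Vertex : ℕ → Set
Vertex N = Fin N ⊎ Fin N

degree : ∀ {N} → BipGraph N → Vertex N → ℕ
degree {N} G (inj₁ i) = length (filter (λ j → T? (G i j)) (allFin N))
degree {N} G (inj₂ j) = length (filter (λ i → T? (G i j)) (allFin N))

MinDegGT3/4 : ∀ {N} → BipGraph N → Set
MinDegGT3/4 {N} G = ∀ (v : Vertex N) → 3 * N < 4 * degree G v

data Colour : Set where
  red blue : Colour

-- a red-blue edge-colouring (only its values on edges matter)
Colouring : ℕ → Set
Colouring N = Fin N → Fin N → Colour

ColEdge : ∀ {N} → BipGraph N → Colouring N → Colour → Fin N → Fin N → Set
ColEdge G χ c i j = T (G i j) × χ i j ≡ c

data Reach {N} (G : BipGraph N) (χ : Colouring N) (c : Colour)
     : Vertex N → Vertex N → Set where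
  here  : ∀ {v} → Reach G χ c v v
  stepʳ : ∀ {i j w} → ColEdge G χ c i j →
          Reach G χ c (inj₂ j) w → Reach G χ c (inj₁ i) w
  stepˡ : ∀ {i j w} → ColEdge G χ c i j →
          Reach G χ c (inj₁ i) w → Reach G χ c (inj₂ j) w

record ConnMatching {N} (G : BipGraph N) (χ : Colouring N) (c : Colour) (k : ℕ) : Set where
  field
    left  : Fin k → Fin N
    right : Fin k → Fin N
    edges : ∀ t → ColEdge G χ c (left t) (right t)
    left-inj  : Injective _≡_ _≡_ left
    right-inj : Injective _≡_ _≡_ right
    connected : ∀ s t → Reach G χ c (inj₁ (left s)) (inj₁ (left t))

{-# OPTIONS --safe #-}
module Submission where

-- Write N = m + n - 1. If no monochromatic connected matching of the required size exists, König's
-- theorem covers the edges of each red component R by a set P R of at most p = m - 1 vertices and those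
-- of each blue component s by a set Q s of at most q = n - 1 vertices, where p + q < N and 2q < N.
-- Hence the vertices free of P R ∪ Q s number more than N, and both sides contain some of them.
--
-- Each vertex lies in one red component (its row) and one blue component (its column); adjacent
-- vertices share a row or a column, and a vertex misses fewer than N/4 vertices of the other side.
-- If the left side lay in one row or column, one colour would have a single component and the
-- vertices free of P R ∪ Q s would span no edge. So two left vertices differ in both row and column;
-- their common neighbours fill two cells, and one of these, (R , s), is so large that every left
-- vertex lies on the cross "row R or column s". Likewise the right side lies on a cross (k , l), and
-- k = R or l = s. Counting free vertices refutes each of the three cases: equal crosses, a shared
-- row, and a shared column; only the last two use 2q < N.

open import Defs
open import Data.Nat using (ℕ; _+_; _∸_; _<_)
open import Data.Sum using (_⊎_)

open import Data.Bool using (Bool; true; false; T; _∧_; _∨_; if_then_else_)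
open import Data.Bool.Properties using (T?; T-∧; T-∨)
open import Data.Empty using (⊥; ⊥-elim)
open import Data.Fin using (Fin; zero; suc; fromℕ<)
open import Data.Fin.Properties using (suc-injective; any?) renaming (_≟_ to _≟ᶠ_)
open import Data.List using (List; []; _∷_; length; filter; tabulate; allFin; cartesianProduct)
open import Data.List.Membership.Propositional using (_∈_)
open import Data.List.Membership.Propositional.Properties using (∈-allFin; ∈-cartesianProduct⁺)
open import Data.List.Relation.Unary.Any using (here; there)
open import Data.Nat using (zero; suc; _*_; _≤_; z≤n; s≤s; _<?_)
open import Data.Nat.Properties using (≤-refl; ≤-reflexive; ≤-trans; ≤-total; ≤-pred; <-irrefl; <-trans; ≮⇒≥; ≰⇒>; m≤m+n; m≤n+m; +-mono-≤; *-monoʳ-≤; +-suc; +-comm)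
open import Data.Nat.Tactic.RingSolver using (solve)
open import Data.Product using (Σ; ∃; _×_; _,_; proj₁; proj₂)
open import Data.Sum using (inj₁; inj₂; [_,_]′) renaming (map to ⊎-map; swap to ⊎-swap)
open import Data.Sum.Properties using () renaming (≡-dec to ⊎-≡-dec)
open import Data.Unit using (⊤; tt)
open import Function using (_∘_; id; Equivalence)
open import Function.Definitions using (Injective)
open import Relation.Binary.Definitions using (DecidableEquality)
open import Relation.Binary.PropositionalEquality using (_≡_; _≢_; refl; sym; trans; cong; subst)
open import Relation.Nullary using (¬_; Dec; yes; no; does; ¬?; _×-dec_; _⊎-dec_; decidable-stable)
open import Relation.Unary using (Decidable)

-- Linear inequalities

infixl 6 _⊕_
infixr 7 _⊛_

_⊕_ : ∀ {a b c d} → a ≤ b → c ≤ d → a + c ≤ b + d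
_⊕_ = +-mono-≤

_⊛_ : ∀ {a b} k → a ≤ b → k * a ≤ k * b
k ⊛ h = *-monoʳ-≤ k h

-- Concludes a Farkas-style refutation: a positive combination of the hypotheses
-- whose left side exceeds its right side by 1 + k.
exceeds : ∀ {a b} k → a ≤ b → a ≡ suc (b + k) → ⊥
exceeds {a} {b} k h e = <-irrefl refl (≤-trans (s≤s (m≤m+n b k)) (subst (_≤ b) e h))

-- Counting

indicator : {A : Set} → Dec A → ℕ
indicator d = if does d then 1 else 0

count : ∀ {n} {P : Fin n → Set} → Decidable P → ℕ
count {zero}  P? = 0
count {suc n} P? = indicator (P? zero) + count (λ i → P? (suc i))

+-interchange : ∀ a b c d → (a + b) + (c + d) ≡ (a + c) + (b + d)
+-interchange a b c d = solve (a ∷ b ∷ c ∷ d ∷ [])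

indicator-∪ : {A B C : Set} (a : Dec A) (b : Dec B) (c : Dec C) → (A → B ⊎ C) →
  indicator a ≤ indicator b + indicator c
indicator-∪ (no _)  b       c       h = z≤n
indicator-∪ (yes a) (yes _) c       h = s≤s z≤n
indicator-∪ (yes a) (no _)  (yes _) h = s≤s z≤n
indicator-∪ (yes a) (no ¬b) (no ¬c) h = ⊥-elim ([ ¬b , ¬c ]′ (h a))

indicator-⊎ : {A B C : Set} (a : Dec A) (b : Dec B) (c : Dec C) →
  (B → A) → (C → A) → (B → C → ⊥) → indicator b + indicator c ≤ indicator a
indicator-⊎ a       (no _)  (no _)  f g h = z≤n
indicator-⊎ a       (yes b) (yes c) f g h = ⊥-elim (h b c)
indicator-⊎ (yes _) (yes _) (no _)  f g h = s≤s z≤n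
indicator-⊎ (yes _) (no _)  (yes _) f g h = s≤s z≤n
indicator-⊎ (no ¬a) (yes b) (no _)  f g h = ⊥-elim (¬a (f b))
indicator-⊎ (no ¬a) (no _)  (yes c) f g h = ⊥-elim (¬a (g c))

count-∪ : ∀ {n} {P Q R : Fin n → Set} (P? : Decidable P) (Q? : Decidable Q) (R? : Decidable R) →
  (∀ i → P i → Q i ⊎ R i) → count P? ≤ count Q? + count R?
count-∪ {n = zero}  P? Q? R? h = z≤n
count-∪ {n = suc n} P? Q? R? h = ≤-trans
  (indicator-∪ (P? zero) (Q? zero) (R? zero) (h zero) ⊕ count-∪ (P? ∘ suc) (Q? ∘ suc) (R? ∘ suc) (h ∘ suc))
  (≤-reflexive (+-interchange (indicator (Q? zero)) (indicator (R? zero)) (count (Q? ∘ suc)) (count (R? ∘ suc))))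

count-⊎ : ∀ {n} {P Q R : Fin n → Set} (P? : Decidable P) (Q? : Decidable Q) (R? : Decidable R) →
  (∀ i → Q i → P i) → (∀ i → R i → P i) → (∀ i → Q i → R i → ⊥) →
  count Q? + count R? ≤ count P?
count-⊎ {n = zero}  P? Q? R? f g h = z≤n
count-⊎ {n = suc n} P? Q? R? f g h = ≤-trans
  (≤-reflexive (+-interchange (indicator (Q? zero)) (count (Q? ∘ suc)) (indicator (R? zero)) (count (R? ∘ suc))))
  (indicator-⊎ (P? zero) (Q? zero) (R? zero) (f zero) (g zero) (h zero)
    ⊕ count-⊎ (P? ∘ suc) (Q? ∘ suc) (R? ∘ suc) (f ∘ suc) (g ∘ suc) (h ∘ suc))

count-empty : ∀ {n} {P : Fin n → Set} (P? : Decidable P) → (∀ i → ¬ P i) → count P? ≡ 0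
count-empty {n = zero}  P? h = refl
count-empty {n = suc n} P? h with P? zero
... | yes p = ⊥-elim (h zero p)
... | no _  = count-empty (P? ∘ suc) (h ∘ suc)

count-mono : ∀ {n} {P Q : Fin n → Set} (P? : Decidable P) (Q? : Decidable Q) → (∀ i → P i → Q i) → count P? ≤ count Q?
count-mono {n = zero}  P? Q? h = z≤n
count-mono {n = suc n} P? Q? h with P? zero | Q? zero
... | no _  | q     = ≤-trans (count-mono (P? ∘ suc) (Q? ∘ suc) (h ∘ suc)) (m≤n+m _ (indicator q))
... | yes _ | yes _ = s≤s (count-mono (P? ∘ suc) (Q? ∘ suc) (h ∘ suc))
... | yes p | no ¬q = ⊥-elim (¬q (h zero p))

count-full : ∀ {n} {P : Fin n → Set} (P? : Decidable P) → (∀ i → P i) → count {n} P? ≡ n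
count-full {n = zero}  P? h = refl
count-full {n = suc n} P? h with P? zero
... | yes _ = cong suc (count-full (P? ∘ suc) (h ∘ suc))
... | no ¬p = ⊥-elim (¬p (h zero))

all-of : ∀ n → Decidable {A = Fin n} (λ _ → ⊤)
all-of n _ = yes tt

count-≤ : ∀ {n} {P : Fin n → Set} (P? : Decidable P) → count {n} P? ≤ n
count-≤ {n = n} P? = ≤-trans (count-mono P? (all-of n) _) (≤-reflexive (count-full (all-of n) _))

count-cover₂ : ∀ {n} {P Q : Fin n → Set} (P? : Decidable P) (Q? : Decidable Q) → (∀ (i : Fin n) → P i ⊎ Q i) →
  n ≤ count P? + count Q?
count-cover₂ {n = n} P? Q? h =
  ≤-trans (≤-reflexive (sym (count-full (all-of n) _))) (count-∪ (all-of n) P? Q? (λ i _ → h i))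

count-∪₃ : ∀ {n} {P Q R S : Fin n → Set} (P? : Decidable P) (Q? : Decidable Q) (R? : Decidable R) (S? : Decidable S) →
  (∀ i → P i → Q i ⊎ R i ⊎ S i) → count P? ≤ count Q? + (count R? + count S?)
count-∪₃ {P = P} {Q = Q} P? Q? R? S? h = ≤-trans
  (count-∪ P? Q? (λ i → P? i ×-dec ¬? (Q? i)) split)
  (≤-refl {count Q?} ⊕ count-∪ (λ i → P? i ×-dec ¬? (Q? i)) R? S? rest)
  where
  split : ∀ i → P i → Q i ⊎ (P i × ¬ Q i)
  split i p with Q? i
  ... | yes q = inj₁ q
  ... | no ¬q = inj₂ (p , ¬q)
  rest : ∀ i → P i × ¬ Q i → _
  rest i (p , ¬q) = [ (λ q → ⊥-elim (¬q q)) , id ]′ (h i p)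

count-cover₃ : ∀ {n} {P Q R : Fin n → Set} (P? : Decidable P) (Q? : Decidable Q) (R? : Decidable R) →
  (∀ (i : Fin n) → P i ⊎ Q i ⊎ R i) → n ≤ count P? + (count Q? + count R?)
count-cover₃ {n = n} P? Q? R? h =
  ≤-trans (≤-reflexive (sym (count-full (all-of n) _))) (count-∪₃ (all-of n) P? Q? R? (λ i _ → h i))

count-pos : ∀ {n} {P : Fin n → Set} (P? : Decidable P) → ∀ i → P i → 0 < count P?
count-pos P? zero p with P? zero
... | yes _ = s≤s z≤n
... | no ¬p = ⊥-elim (¬p p)
count-pos P? (suc i) p = ≤-trans (count-pos (P? ∘ suc) i p) (m≤n+m _ (indicator (P? zero)))

count-witness : ∀ {n} {P : Fin n → Set} (P? : Decidable P) → 0 < count P? → ∃ P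
count-witness P? h with any? P?
... | yes w = w
... | no ¬w = ⊥-elim (<-irrefl (sym (count-empty P? (λ i p → ¬w (i , p)))) h)

-- Induction on `k`: the value `f zero` is split off from `P`, and injectivity keeps the later
-- values in the remaining part.
count-injective : ∀ {n k} {P : Fin n → Set} (P? : Decidable P) (f : Fin k → Fin n) → Injective _≡_ _≡_ f →
  count (λ t → P? (f t)) ≤ count P?
count-injective {k = zero}  P? f inj = z≤n
count-injective {k = suc k} P? f inj = ≤-trans
  (first ⊕ ≤-trans (count-mono (P? ∘ f ∘ suc) (P′? ∘ f ∘ suc) (λ t p → p , λ e → 0≢ (inj e)))
                   (count-injective P′? (f ∘ suc) (suc-injective ∘ inj)))
  (count-⊎ P? Z? P′? (λ _ → proj₁) (λ _ → proj₁) (λ { i (_ , e) (_ , ¬e) → ¬e e }))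
  where
  Z? = λ i → P? i ×-dec (i ≟ᶠ f zero)
  P′? = λ i → P? i ×-dec ¬? (i ≟ᶠ f zero)
  0≢ : ∀ {t : Fin k} → suc t ≢ zero
  0≢ ()
  first : indicator (P? (f zero)) ≤ count Z?
  first with P? (f zero)
  ... | yes p = count-pos Z? (f zero) (p , refl)
  ... | no _  = z≤n

length-filter-tabulate : ∀ {n} {A : Set} {X : A → Set} (X? : Decidable X) (f : Fin n → A) →
  length (filter X? (tabulate f)) ≡ count (λ i → X? (f i))
length-filter-tabulate {n = zero}  X? f = refl
length-filter-tabulate {n = suc n} X? f with X? (f zero)
... | yes _ = cong suc (length-filter-tabulate X? (f ∘ suc))
... | no _  = length-filter-tabulate X? (f ∘ suc)

-- Checked point by point; on both sides of the graph at once it compares two covers with their meet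
-- and join.
count-∧-∨ : ∀ {n} (f g : Fin n → Bool) →
  count (λ i → T? (f i ∧ g i)) + count (λ i → T? (f i ∨ g i)) ≤ count (T? ∘ f) + count (T? ∘ g)
count-∧-∨ {n = zero}  f g = z≤n
count-∧-∨ {n = suc n} f g = ≤-trans
  (≤-reflexive (+-interchange (indicator (T? (f zero ∧ g zero))) (count (λ i → T? (f (suc i) ∧ g (suc i))))
                              (indicator (T? (f zero ∨ g zero))) (count (λ i → T? (f (suc i) ∨ g (suc i))))))
  (≤-trans (point (f zero) (g zero) ⊕ count-∧-∨ (f ∘ suc) (g ∘ suc))
    (≤-reflexive (+-interchange (indicator (T? (f zero))) (indicator (T? (g zero)))
                                (count (T? ∘ f ∘ suc)) (count (T? ∘ g ∘ suc)))))
  where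
  point : ∀ x y → indicator (T? (x ∧ y)) + indicator (T? (x ∨ y)) ≤ indicator (T? x) + indicator (T? y)
  point false false = z≤n
  point false true  = s≤s z≤n
  point true  false = s≤s z≤n
  point true  true  = s≤s (s≤s z≤n)

⊎-∀ : ∀ {n} {A : Set} {B : Fin n → Set} → (∀ i → A ⊎ B i) → A ⊎ (∀ i → B i)
⊎-∀ {n = zero}  h = inj₂ λ ()
⊎-∀ {n = suc n} h with h zero | ⊎-∀ (h ∘ suc)
... | inj₁ a | _      = inj₁ a
... | inj₂ _ | inj₁ a = inj₁ a
... | inj₂ b | inj₂ c = inj₂ λ { zero → b ; (suc i) → c i }

-- König's theorem

record Matching {M N} (E : Fin M → Fin N → Set) (k : ℕ) : Set where
  field
    left      : Fin k → Fin M
    right     : Fin k → Fin N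
    edges     : ∀ t → E (left t) (right t)
    left-inj  : Injective _≡_ _≡_ left
    right-inj : Injective _≡_ _≡_ right

-- The bound in `size` is strict so that a cover is the exact alternative to a matching of size `k`.
record Cover {M N} (E : Fin M → Fin N → Set) (k : ℕ) : Set where
  field
    inˡ    : Fin M → Bool
    inʳ    : Fin N → Bool
    covers : ∀ {i j} → E i j → T (inˡ i) ⊎ T (inʳ j)
    size   : count (T? ∘ inˡ) + count (T? ∘ inʳ) < k

matching≤cover : ∀ {M N k} {E : Fin M → Fin N → Set} → Matching E k →
  (f : Fin M → Bool) (g : Fin N → Bool) → (∀ {i j} → E i j → T (f i) ⊎ T (g j)) →
  k ≤ count (T? ∘ f) + count (T? ∘ g)
matching≤cover μ f g h = ≤-trans
  (count-cover₂ (T? ∘ f ∘ left) (T? ∘ g ∘ right) (λ t → h (edges t)))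
  (count-injective (T? ∘ f) left left-inj ⊕ count-injective (T? ∘ g) right right-inj)
  where open Matching μ

-- Minimum covers form a lattice: when a matching of size k exists, the "meet" cover
-- has at least k vertices, so the "join" cover has at most k.
join : ∀ {M N k} {E : Fin M → Fin N → Set} → Matching E k → (C D : Cover E (suc k)) →
  Σ (Cover E (suc k)) λ J → ∀ j → T (Cover.inʳ C j) ⊎ T (Cover.inʳ D j) → T (Cover.inʳ J j)
join {k = k} {E = E} μ C D = record
  { inˡ = λ i → C.inˡ i ∧ D.inˡ i ; inʳ = λ j → C.inʳ j ∨ D.inʳ j
  ; covers = λ e → both (C.covers e) (D.covers e)
  ; size = s≤s (≮⇒≥ λ lt → arith
      (count (T? ∘ C.inˡ)) (count (T? ∘ C.inʳ)) (count (T? ∘ D.inˡ)) (count (T? ∘ D.inʳ))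
      (count (λ i → T? (C.inˡ i ∧ D.inˡ i))) (count (λ i → T? (C.inˡ i ∨ D.inˡ i)))
      (count (λ j → T? (C.inʳ j ∧ D.inʳ j))) (count (λ j → T? (C.inʳ j ∨ D.inʳ j)))
      C.size D.size
      (count-∧-∨ C.inˡ D.inˡ)
      (count-∧-∨ C.inʳ D.inʳ)
      (matching≤cover μ (λ i → C.inˡ i ∨ D.inˡ i) (λ j → C.inʳ j ∧ D.inʳ j)
        (λ e → either (C.covers e) (D.covers e)))
      lt) }
  , λ j → Equivalence.from T-∨
  where
  module C = Cover C
  module D = Cover D
  both : ∀ {w x y z} → T w ⊎ T x → T y ⊎ T z → T (w ∧ y) ⊎ T (x ∨ z)
  both (inj₁ a) (inj₁ b) = inj₁ (Equivalence.from T-∧ (a , b))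
  both (inj₁ a) (inj₂ b) = inj₂ (Equivalence.from T-∨ (inj₂ b))
  both (inj₂ a) _        = inj₂ (Equivalence.from T-∨ (inj₁ a))
  either : ∀ {w x y z} → T w ⊎ T x → T y ⊎ T z → T (w ∨ y) ⊎ T (x ∧ z)
  either (inj₁ a) _        = inj₁ (Equivalence.from T-∨ (inj₁ a))
  either (inj₂ a) (inj₁ b) = inj₁ (Equivalence.from T-∨ (inj₂ b))
  either (inj₂ a) (inj₂ b) = inj₂ (Equivalence.from T-∧ (a , b))
  arith : ∀ a b c d x y z w → a + b < suc k → c + d < suc k →
    x + y ≤ a + c → z + w ≤ b + d → k ≤ y + z → k < x + w → ⊥
  arith a b c d x y z w h₁ h₂ h₃ h₄ h₅ h₆ =
    exceeds 0 (h₁ ⊕ h₂ ⊕ h₃ ⊕ h₄ ⊕ h₅ ⊕ h₆) (solve (k ∷ a ∷ b ∷ c ∷ d ∷ x ∷ y ∷ z ∷ w ∷ []))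

-- Induction on `M`, removing the left vertex `zero`. In the critical case the rest has a matching
-- of size `k` and a cover of `k` vertices. Either some neighbour of `zero` is avoided by a matching
-- of size `k` in the rest, which then extends, or every neighbour lies in a cover of at most `k`
-- vertices. Joining these covers yields one that contains all neighbours of `zero`, so it covers
-- the edges at `zero` as well.
könig : ∀ {M N} (E : Fin M → Fin N → Set) → (∀ i j → Dec (E i j)) → ∀ k →
  Matching E k ⊎ Cover E k
könig E E? zero = inj₁ record
  { left = λ () ; right = λ () ; edges = λ () ; left-inj = λ {} ; right-inj = λ {} }
könig {zero} {N} E E? (suc k) = inj₂ record
  { inˡ = λ () ; inʳ = λ _ → false ; covers = λ {}
  ; size = s≤s (≤-trans (≤-reflexive (count-empty {n = N} (λ _ → T? false) (λ _ ()))) z≤n) }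
könig {suc M} {N} E E? (suc k) = step (könig E′ E′? (suc k)) (könig E′ E′? k)
  where
  E′ : Fin M → Fin N → Set
  E′ i j = E (suc i) j
  E′? = λ i j → E? (suc i) j

  avoiding : Fin N → Fin M → Fin N → Set
  avoiding b i j = E′ i j × j ≢ b

  Through : Fin N → Set
  Through b = E zero b → Σ (Cover E′ (suc k)) λ C → T (Cover.inʳ C b)

  extend : ∀ b → Matching (avoiding b) k → E zero b → Matching E (suc k)
  extend b μ e = record
    { left = λ { zero → zero ; (suc t) → suc (left t) }
    ; right = λ { zero → b ; (suc t) → right t }
    ; edges = λ { zero → e ; (suc t) → proj₁ (edges t) }
    ; left-inj = λ { {zero} {zero} _ → refl ; {suc _} {suc _} p → cong suc (left-inj (suc-injective p)) }
    ; right-inj = λ { {zero} {zero} _ → refl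
                    ; {zero} {suc t} p → ⊥-elim (proj₂ (edges t) (sym p))
                    ; {suc t} {zero} p → ⊥-elim (proj₂ (edges t) p)
                    ; {suc _} {suc _} p → cong suc (right-inj p) } }
    where open Matching μ

  through : ∀ b → Cover (avoiding b) k → Through b
  through b C _ = record
    { inˡ = C.inˡ ; inʳ = λ j → C.inʳ j ∨ does (j ≟ᶠ b)
    ; covers = λ {i} {j} e → cov i j e
    ; size = s≤s (≤-trans (≤-trans (≤-refl ⊕ grow) (≤-reflexive (+-suc _ _))) C.size) }
    , Equivalence.from T-∨ (inj₂ self)
    where
    module C = Cover C
    self : T (does (b ≟ᶠ b))
    self with b ≟ᶠ b
    ... | yes _ = tt
    ... | no ¬e = ¬e refl
    cov : ∀ i j → E′ i j → T (C.inˡ i) ⊎ T (C.inʳ j ∨ does (j ≟ᶠ b))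
    cov i j e with j ≟ᶠ b
    ... | yes _ = inj₂ (Equivalence.from T-∨ (inj₂ tt))
    ... | no ¬p = ⊎-map id (λ t → Equivalence.from T-∨ (inj₁ t)) (C.covers (e , ¬p))
    one : ∀ {n} (b : Fin n) → count (λ j → T? (does (j ≟ᶠ b))) ≤ 1
    one {suc n} zero    = s≤s (≤-reflexive (count-empty {n = n} (λ j → T? (does (suc j ≟ᶠ zero))) (λ _ ())))
    one {suc n} (suc b) = ≤-trans
      (count-mono (λ j → T? (does (suc j ≟ᶠ suc b))) (λ j → T? (does (j ≟ᶠ b))) shift) (one b)
      where
      shift : ∀ j → T (does (suc j ≟ᶠ suc b)) → T (does (j ≟ᶠ b))
      shift j t with j ≟ᶠ b
      ... | yes _ = tt
      ... | no _  = t
    grow : count (λ j → T? (C.inʳ j ∨ does (j ≟ᶠ b))) ≤ suc (count (T? ∘ C.inʳ))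
    grow = ≤-trans
      (count-∪ (λ j → T? (C.inʳ j ∨ does (j ≟ᶠ b))) (λ j → T? (does (j ≟ᶠ b))) (T? ∘ C.inʳ)
        (λ j → ⊎-swap ∘ Equivalence.to T-∨))
      (one b ⊕ ≤-refl)

  try : Matching E′ k → ∀ b → Matching E (suc k) ⊎ Through b
  try μ b with E? zero b
  ... | no ¬e = inj₂ λ e → ⊥-elim (¬e e)
  ... | yes e with könig (avoiding b) (λ i j → E′? i j ×-dec ¬? (j ≟ᶠ b)) k
  ...   | inj₁ ν = inj₁ (extend b ν e)
  ...   | inj₂ C = inj₂ (through b C)

  collect : Matching E′ k → Cover E′ (suc k) → (∀ b → Through b) → (bs : List (Fin N)) →
    Σ (Cover E′ (suc k)) λ C → ∀ b → b ∈ bs → E zero b → T (Cover.inʳ C b)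
  collect μ C₀ th [] = C₀ , λ _ ()
  collect μ C₀ th (b ∷ bs) with collect μ C₀ th bs | E? zero b
  ... | C , h | no ¬e = C , λ { _ (here refl) e → ⊥-elim (¬e e) ; b′ (there m) e → h b′ m e }
  ... | C , h | yes e with join μ C (proj₁ (th b e))
  ...   | J , up = J , λ { _ (here refl) _ → up b (inj₂ (proj₂ (th b e))) ; b′ (there m) e′ → up b′ (inj₁ (h b′ m e′)) }

  step : Matching E′ (suc k) ⊎ Cover E′ (suc k) → Matching E′ k ⊎ Cover E′ k →
    Matching E (suc k) ⊎ Cover E (suc k)
  step (inj₁ μ) _ = inj₁ record
    { left = suc ∘ left ; right = right ; edges = edges
    ; left-inj = left-inj ∘ suc-injective ; right-inj = right-inj }
    where open Matching μ
  step (inj₂ _) (inj₂ C) = inj₂ record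
    { inˡ = λ { zero → true ; (suc i) → C.inˡ i } ; inʳ = C.inʳ
    ; covers = λ { {zero} _ → inj₁ tt ; {suc i} e → C.covers e }
    ; size = s≤s C.size }
    where module C = Cover C
  step (inj₂ C₀) (inj₁ μ) with ⊎-∀ (try μ)
  ... | inj₁ ν = inj₁ ν
  ... | inj₂ th with collect μ C₀ th (allFin N)
  ...   | C , h = inj₂ record
    { inˡ = λ { zero → false ; (suc i) → Cover.inˡ C i } ; inʳ = Cover.inʳ C
    ; covers = λ { {zero} {j} e → inj₂ (h j (∈-allFin j) e) ; {suc i} e → Cover.covers C e }
    ; size = Cover.size C }

-- Two-coloured bipartite graphs with covered components

search : ∀ {n} {P : Fin n → Set} → Decidable P → ∃ P ⊎ (∀ i → ¬ P i)
search P? with any? P?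
... | yes w = inj₁ w
... | no ¬w = inj₂ λ i p → ¬w (i , p)

dec-cases : {X Y : Set} → Dec X → Dec Y → (X × Y) ⊎ (X × ¬ Y) ⊎ ¬ X
dec-cases (yes x) (yes y) = inj₁ (x , y)
dec-cases (yes x) (no ¬y) = inj₂ (inj₁ (x , ¬y))
dec-cases (no ¬x) _       = inj₂ (inj₂ ¬x)

dec-remove : {X Y : Set} → Dec Y → X → (X × ¬ Y) ⊎ Y
dec-remove (yes y) x = inj₂ y
dec-remove (no ¬y) x = inj₁ (x , ¬y)

neither : {X Y : Set} → ¬ X → ¬ Y → X ⊎ Y → ⊥
neither = [_,_]′

-- Used with `exceptA`: when some vertex sees only exceptional elements of a set, and fewer than N/4
-- are exceptional, the set has fewer than N/2 elements.
half-bound : ∀ {N} f x → 4 * f < N + 4 * x → 4 * x < N → 4 * f < 2 * N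
half-bound {N} f x h₁ h₂ = ≰⇒> λ (h₃ : 2 * N ≤ 4 * f) → exceeds 1 (h₁ ⊕ h₂ ⊕ h₃) (solve (N ∷ f ∷ x ∷ []))

module Configurations {L : Set} (_≟_ : DecidableEquality L) where

  -- Labels agree along an edge of the colour concerned, and one end lies in the
  -- cover attached to the common label.
  Hit : L → L → (L → Bool) → (L → Bool) → Set
  Hit x y X Y = x ≡ y × (∀ {ℓ} → x ≡ ℓ → T (X ℓ) ⊎ T (Y ℓ))

  Hit-sym : ∀ {x y X Y} → Hit x y X Y → Hit y x Y X
  Hit-sym (e , h) = sym e , λ e′ → ⊎-swap (h (trans e e′))

  -- A and B are the two sides, r and b the red and blue component labels, and P ℓ and Q ℓ
  -- the covers of the red and of the blue component labelled ℓ.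
  record Config (N p q : ℕ) : Set where
    field
      adj         : Fin N → Fin N → Bool
      rA bA rB bB : Fin N → L
      PA PB QA QB : L → Fin N → Bool
      edge  : ∀ {u w} → T (adj u w) →
              Hit (rA u) (rB w) (λ ℓ → PA ℓ u) (λ ℓ → PB ℓ w) ⊎
              Hit (bA u) (bB w) (λ ℓ → QA ℓ u) (λ ℓ → QB ℓ w)
      sizeP : ∀ ℓ → count (T? ∘ PA ℓ) + count (T? ∘ PB ℓ) ≤ p
      sizeQ : ∀ ℓ → count (T? ∘ QA ℓ) + count (T? ∘ QB ℓ) ≤ q
      p+q<N : p + q < N
      degA  : ∀ u → 4 * count (λ w → ¬? (T? (adj u w))) < N
      degB  : ∀ w → 4 * count (λ u → ¬? (T? (adj u w))) < N

    freeA? : ∀ R s → Decidable (λ u → ¬ T (PA R u) × ¬ T (QA s u))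
    freeA? R s u = ¬? (T? (PA R u)) ×-dec ¬? (T? (QA s u))

    freeB? : ∀ R s → Decidable (λ w → ¬ T (PB R w) × ¬ T (QB s w))
    freeB? R s w = ¬? (T? (PB R w)) ×-dec ¬? (T? (QB s w))

  flip : ∀ {N p q} → Config N p q → Config N p q
  flip C = record
    { adj = λ w u → adj u w ; rA = rB ; bA = bB ; rB = rA ; bB = bA
    ; PA = PB ; PB = PA ; QA = QB ; QB = QA
    ; edge = λ e → ⊎-map Hit-sym Hit-sym (edge e)
    ; sizeP = λ ℓ → ≤-trans (≤-reflexive (+-comm (count (T? ∘ PB ℓ)) _)) (sizeP ℓ)
    ; sizeQ = λ ℓ → ≤-trans (≤-reflexive (+-comm (count (T? ∘ QB ℓ)) _)) (sizeQ ℓ)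
    ; p+q<N = p+q<N ; degA = degB ; degB = degA }
    where open Config C

  -- Possible because `Config` asks only for the symmetric `p + q < N`; the inequality `2 * q < N`,
  -- which distinguishes the colours, is passed separately.
  swap-colours : ∀ {N p q} → Config N p q → Config N q p
  swap-colours {p = p} {q} C = record
    { adj = adj ; rA = bA ; bA = rA ; rB = bB ; bB = rB
    ; PA = QA ; PB = QB ; QA = PA ; QB = PB
    ; edge = λ e → ⊎-swap (edge e) ; sizeP = sizeQ ; sizeQ = sizeP
    ; p+q<N = ≤-trans (≤-reflexive (cong suc (+-comm q p))) p+q<N ; degA = degA ; degB = degB }
    where open Config C

  -- Non-neighbours and free vertices

  module Degree {N p q} (C : Config N p q) where
    open Config C

    -- Elements of `X` outside `Y` are non-neighbours of `u`, of which there are fewer than N/4.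
    exceptA : ∀ u {X Y : Fin N → Set} (X? : Decidable X) (Y? : Decidable Y) →
      (∀ w → X w → T (adj u w) → Y w) → 4 * count X? < N + 4 * count Y?
    exceptA u {X} {Y} X? Y? h = arith (count X?) (count Y?) (count (λ w → ¬? (T? (adj u w))))
      (count-∪ X? (λ w → ¬? (T? (adj u w))) Y? split) (degA u)
      where
      split : ∀ w → X w → ¬ T (adj u w) ⊎ Y w
      split w x with T? (adj u w)
      ... | yes e = inj₂ (h w x e)
      ... | no ¬e = inj₁ ¬e
      arith : ∀ x y z → x ≤ z + y → 4 * z < N → 4 * x < N + 4 * y
      arith x y z h₁ h₂ = ≰⇒> λ (h₃ : N + 4 * y ≤ 4 * x) → exceeds 0 (4 ⊛ h₁ ⊕ h₂ ⊕ h₃) (solve (N ∷ x ∷ y ∷ z ∷ []))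

    farA : ∀ u {X : Fin N → Set} (X? : Decidable X) →
      (∀ w → X w → T (adj u w) → ⊥) → 4 * count X? < N
    farA u X? h = ≤-trans (s≤s (4 ⊛ count-mono X? (λ w → ¬? (T? (adj u w))) h)) (degA u)

    -- The two covers together occupy at most `p + q`, hence fewer than N, of the 2N vertices.
    freeA+freeB : ∀ R s → N < count (freeA? R s) + count (freeB? R s)
    freeA+freeB R s = arith (count (freeA? R s)) (count (freeB? R s))
      (count (T? ∘ PA R)) (count (T? ∘ PB R)) (count (T? ∘ QA s)) (count (T? ∘ QB s))
      (count-cover₃ (freeA? R s) (T? ∘ PA R) (T? ∘ QA s) (λ u → split (T? (PA R u)) (T? (QA s u))))
      (count-cover₃ (freeB? R s) (T? ∘ PB R) (T? ∘ QB s) (λ w → split (T? (PB R w)) (T? (QB s w))))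
      (sizeP R) (sizeQ s)
      where
      split : ∀ {X Y : Set} → Dec X → Dec Y → (¬ X × ¬ Y) ⊎ X ⊎ Y
      split (yes x) _       = inj₂ (inj₁ x)
      split (no _)  (yes y) = inj₂ (inj₂ y)
      split (no x)  (no y)  = inj₁ (x , y)
      arith : ∀ fa fb pa pb qa qb → N ≤ fa + (pa + qa) → N ≤ fb + (pb + qb) →
        pa + pb ≤ p → qa + qb ≤ q → N < fa + fb
      arith fa fb pa pb qa qb h₁ h₂ h₃ h₄ = ≰⇒> λ (h₅ : fa + fb ≤ N) → exceeds 0 (h₁ ⊕ h₂ ⊕ h₃ ⊕ h₄ ⊕ h₅ ⊕ p+q<N)
        (solve (N ∷ p ∷ q ∷ fa ∷ fb ∷ pa ∷ pb ∷ qa ∷ qb ∷ []))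

    freeA-witness : ∀ R s → ∃ λ u → ¬ T (PA R u) × ¬ T (QA s u)
    freeA-witness R s = count-witness (freeA? R s)
      (arith (count (freeA? R s)) (count (freeB? R s)) (freeA+freeB R s) (count-≤ (freeB? R s)))
      where
      arith : ∀ x y → N < x + y → y ≤ N → 0 < x
      arith x y h₁ h₂ = ≰⇒> λ (h₃ : x ≤ 0) → exceeds 0 (h₁ ⊕ h₂ ⊕ h₃) (solve (N ∷ x ∷ y ∷ []))

  module _ {N p q} (C : Config N p q) where
    open Config C
    open Degree C public
    open Degree (flip C) public using () renaming (exceptA to exceptB; farA to farB)

    freeB-witness : ∀ R s → ∃ λ w → ¬ T (PB R w) × ¬ T (QB s w)
    freeB-witness = Degree.freeA-witness (flip C)

  -- A single component in one colour

  module OneRedComponent {N p q} (C : Config N p q) where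
    open Config C

    -- A condition on edges rather than on all left labels, so that it passes to `flip C`.
    SingleRed : L → Set
    SingleRed R = ∀ {u w} → T (adj u w) → rA u ≡ rB w → rA u ≡ R

    -- Outside the cover all edges are blue, and any two left vertices have a common
    -- neighbour there, so they lie in one blue component.
    module Majority R (single : SingleRed R) (big : N < 2 * count (λ w → ¬? (T? (PB R w)))) where
      WB? = λ w → ¬? (T? (PB R w))

      blue-hit : ∀ {u w} → ¬ T (PA R u) → ¬ T (PB R w) → T (adj u w) →
        Hit (bA u) (bB w) (λ ℓ → QA ℓ u) (λ ℓ → QB ℓ w)
      blue-hit ¬u ¬w a with edge a
      ... | inj₁ (e , h) = ⊥-elim (neither ¬u ¬w (h (single a e)))
      ... | inj₂ b       = b

      -- More than N/2 right vertices avoid the cover, and each of `u` and `v` misses fewer than N/4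
      -- of them.
      common : ∀ u v → ∃ λ w → ¬ T (PB R w) × T (adj u w) × T (adj v w)
      common u v = count-witness X? (arith (count WB?) (count (λ w → ¬? (T? (adj u w))))
          (count (λ w → ¬? (T? (adj v w)))) (count X?)
          (count-∪₃ WB? (λ w → ¬? (T? (adj u w))) (λ w → ¬? (T? (adj v w))) X?
            (λ w f → split f (T? (adj u w)) (T? (adj v w))))
          (degA u) (degA v) big)
        where
        X? = λ w → ¬? (T? (PB R w)) ×-dec (T? (adj u w) ×-dec T? (adj v w))
        split : ∀ {F X Y : Set} → F → Dec X → Dec Y → ¬ X ⊎ ¬ Y ⊎ (F × X × Y)
        split f (no ¬x) _       = inj₁ ¬x
        split f (yes _) (no ¬y) = inj₂ (inj₁ ¬y)
        split f (yes x) (yes y) = inj₂ (inj₂ (f , x , y))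
        arith : ∀ wb y z x → wb ≤ y + (z + x) → 4 * y < N → 4 * z < N → N < 2 * wb → 0 < x
        arith wb y z x h₁ h₂ h₃ h₄ = ≰⇒> λ (h₅ : x ≤ 0) → exceeds 3 (4 ⊛ h₁ ⊕ h₂ ⊕ h₃ ⊕ 2 ⊛ h₄ ⊕ 4 ⊛ h₅)
          (solve (N ∷ wb ∷ y ∷ z ∷ x ∷ []))

      same : ∀ u v → ¬ T (PA R u) → ¬ T (PA R v) → bA u ≡ bA v
      same u v ¬u ¬v with common u v
      ... | w , ¬w , a , a₀ = trans (proj₁ (blue-hit ¬u ¬w a)) (sym (proj₁ (blue-hit ¬v ¬w a₀)))

      -- All left vertices outside `PA R` have the blue label `S`, so a blue edge between free
      -- vertices would escape the cover of `S`. The free sets therefore span no edge and have fewer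
      -- than N/4 elements each, against a total above N.
      conclude : ∀ u₀ → ¬ T (PA R u₀) → ⊥
      conclude u₀ ¬u₀ = clash (count (freeA? R S)) (count (freeB? R S)) (freeA+freeB C R S)
          (farB C (proj₁ w₁) (freeA? R S) (λ u f → sealed f (proj₂ w₁)))
          (farA C (proj₁ u₁) (freeB? R S) (λ w f → sealed (proj₂ u₁) f))
        where
        S = bA u₀
        sealed : ∀ {u w} → ¬ T (PA R u) × ¬ T (QA S u) → ¬ T (PB R w) × ¬ T (QB S w) → T (adj u w) → ⊥
        sealed {u} (¬p , ¬q) (¬p′ , ¬q′) a = neither ¬q ¬q′ (proj₂ (blue-hit ¬p ¬p′ a) (same u u₀ ¬p ¬u₀))
        u₁ = freeA-witness C R S
        w₁ = freeB-witness C R S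
        clash : ∀ fa fb → N < fa + fb → 4 * fa < N → 4 * fb < N → ⊥
        clash fa fb h₁ h₂ h₃ = exceeds (5 + 2 * N) (4 ⊛ h₁ ⊕ h₂ ⊕ h₃) (solve (N ∷ fa ∷ fb ∷ []))

    majority : ∀ R → SingleRed R → N < 2 * count (λ w → ¬? (T? (PB R w))) → ⊥
    majority R single big = conclude (proj₁ u₀) (proj₁ (proj₂ u₀))
      where
      open Majority R single big
      -- Only a vertex outside `PA R` is wanted, so the second label is arbitrary.
      u₀ = freeA-witness C R R

  -- The cover of `R` has fewer than N vertices, so on one of the two sides more than N/2 vertices
  -- lie outside it; `flip` brings that side to the right.
  one-red-component : ∀ {N p q} (C : Config N p q) R → OneRedComponent.SingleRed C R → ⊥
  one-red-component {N} {p} {q} C R single with N <? 2 * count (λ w → ¬? (T? (Config.PB C R w)))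
  ... | yes big = OneRedComponent.majority C R single big
  ... | no ¬big = OneRedComponent.majority (flip C) R (λ a e → trans e (single a (sym e)))
      (arith (count (λ u → ¬? (T? (PA R u)))) (count (λ w → ¬? (T? (PB R w))))
        (count (T? ∘ PA R)) (count (T? ∘ PB R))
        (count-cover₂ (λ u → ¬? (T? (PA R u))) (T? ∘ PA R) (λ u → dec-split (T? (PA R u))))
        (count-cover₂ (λ w → ¬? (T? (PB R w))) (T? ∘ PB R) (λ w → dec-split (T? (PB R w))))
        (sizeP R) p+q<N (≮⇒≥ ¬big))
    where
    open Config C
    dec-split : ∀ {X : Set} → Dec X → ¬ X ⊎ X
    dec-split (yes x) = inj₂ x
    dec-split (no ¬x) = inj₁ ¬x
    arith : ∀ wa wb pa pb → N ≤ wa + pa → N ≤ wb + pb → pa + pb ≤ p → p + q < N → 2 * wb ≤ N → N < 2 * wa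
    arith wa wb pa pb h₁ h₂ h₃ h₄ h₅ = ≰⇒> λ (h₆ : 2 * wa ≤ N) →
      exceeds (1 + 2 * q) (2 ⊛ h₁ ⊕ 2 ⊛ h₂ ⊕ 2 ⊛ h₃ ⊕ 2 ⊛ h₄ ⊕ h₅ ⊕ h₆)
        (solve (N ∷ p ∷ q ∷ wa ∷ wb ∷ pa ∷ pb ∷ []))

  -- Crosses

  all-equal : ∀ {N} (f : Fin N → L) ℓ → (∀ u → f u ≡ ℓ) ⊎ ∃ λ u → f u ≢ ℓ
  all-equal f ℓ with search (λ u → ¬? (f u ≟ ℓ))
  ... | inj₁ w = inj₂ w
  ... | inj₂ h = inj₁ λ u → decidable-stable (f u ≟ ℓ) (h u)

  generic-pair : ∀ {N p q} (C : Config N p q) → let open Config C in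
    ∃ λ u → ∃ λ v → rA u ≢ rA v × bA u ≢ bA v
  generic-pair {N} {p} {q} C = pick (fromℕ< (≤-trans (s≤s z≤n) p+q<N))
    where
    open Config C
    pick : Fin N → ∃ λ u → ∃ λ v → rA u ≢ rA v × bA u ≢ bA v
    pick u₀ with all-equal rA (rA u₀) | all-equal bA (bA u₀)
    ... | inj₁ h | _ = ⊥-elim (one-red-component C (rA u₀) (λ {u} _ _ → h u))
    ... | inj₂ _ | inj₁ h = ⊥-elim (one-red-component (swap-colours C) (bA u₀) (λ {u} _ _ → h u))
    ... | inj₂ (u₁ , r≢) | inj₂ (u₂ , b≢) with bA u₁ ≟ bA u₀ | rA u₂ ≟ rA u₀
    ...   | no b₁≢ | _       = u₁ , u₀ , r≢ , b₁≢
    ...   | yes _  | no r₂≢  = u₂ , u₀ , r₂≢ , b≢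
    -- Here `u₁` shares its column with `u₀` and `u₂` shares its row with `u₀`, so `u₁` and `u₂`
    -- differ in both.
    ...   | yes b₁ | yes r₂  = u₁ , u₂ , (λ e → r≢ (trans e r₂)) , λ e → b≢ (trans (sym e) b₁)

  -- The witnesses `offʳ` and `offᵇ` say that neither arm alone contains the side. The vertex in
  -- `at`, from the opposite side, lies in the centre cell and links the crosses of the two sides.
  record Cross {N} (rA bA rB bB : Fin N → L) (R s : L) : Set where
    field
      on   : ∀ u → rA u ≡ R ⊎ bA u ≡ s
      offʳ : ∃ λ u → rA u ≢ R
      offᵇ : ∃ λ u → bA u ≢ s
      at   : ∃ λ w → rB w ≡ R × bB w ≡ s

  module FindCross {N p q} (C : Config N p q) where
    open Config C

    cell? : ∀ R s → Decidable (λ w → rB w ≡ R × bB w ≡ s)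
    cell? R s w = (rB w ≟ R) ×-dec (bB w ≟ s)

    -- A left vertex off both arms has no neighbour in the cell, and more than N/4 vertices are too
    -- many to miss.
    cross-at : ∀ u v → rA u ≢ rA v → bA u ≢ bA v → N < 4 * count (cell? (rA u) (bA v)) →
      Cross rA bA rB bB (rA u) (bA v)
    cross-at u v r≢ b≢ big = record
      { on = on ; offʳ = v , λ e → r≢ (sym e) ; offᵇ = u , b≢
      ; at = count-witness X? (arith (count X?) big) }
      where
      X? = cell? (rA u) (bA v)
      arith : ∀ x → N < 4 * x → 0 < x
      arith x h = ≰⇒> λ (h₂ : x ≤ 0) → exceeds N (h ⊕ 4 ⊛ h₂) (solve (N ∷ x ∷ []))
      on : ∀ z → rA z ≡ rA u ⊎ bA z ≡ bA v
      on z with rA z ≟ rA u | bA z ≟ bA v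
      ... | yes e | _     = inj₁ e
      ... | no _  | yes e = inj₂ e
      ... | no r  | no b  = ⊥-elim (<-irrefl refl (<-trans big (farA C z X? away)))
        where
        away : ∀ w → rB w ≡ rA u × bB w ≡ bA v → T (adj z w) → ⊥
        away w (e , f) a with edge a
        ... | inj₁ (h , _) = r (trans h e)
        ... | inj₂ (h , _) = b (trans h f)

    -- More than N/2 right vertices are adjacent to both `u` and `v`. Such a vertex shares its row
    -- with one of them and its column with the other, because `u` and `v` differ in both; so one of
    -- the two mixed cells exceeds N/4.
    find-cross : ∃ λ R → ∃ λ s → Cross rA bA rB bB R s
    find-cross with generic-pair C
    ... | u , v , r≢ , b≢ with N <? 4 * count (cell? (rA u) (bA v)) | N <? 4 * count (cell? (rA v) (bA u))
    ...   | yes big | _       = rA u , bA v , cross-at u v r≢ b≢ big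
    ...   | no _    | yes big = rA v , bA u , cross-at v u (λ e → r≢ (sym e)) (λ e → b≢ (sym e)) big
    ...   | no ¬big | no ¬big′ = ⊥-elim (arith (count NU?) (count NV?) (count XY?) (count X?) (count Y?)
        (count-cover₃ NU? NV? XY? common) (count-∪ XY? X? Y? (λ _ → id)) (degA u) (degA v) (≮⇒≥ ¬big) (≮⇒≥ ¬big′))
      where
      NU? = λ w → ¬? (T? (adj u w))
      NV? = λ w → ¬? (T? (adj v w))
      X? = cell? (rA u) (bA v)
      Y? = cell? (rA v) (bA u)
      XY? = λ w → X? w ⊎-dec Y? w
      common : ∀ w → ¬ T (adj u w) ⊎ ¬ T (adj v w) ⊎ _
      common w with T? (adj u w) | T? (adj v w)
      ... | no ¬a | _      = inj₁ ¬a
      ... | yes _ | no ¬a  = inj₂ (inj₁ ¬a)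
      ... | yes a | yes a′ with edge a | edge a′
      ...   | inj₁ (e , _) | inj₁ (f , _) = ⊥-elim (r≢ (trans e (sym f)))
      ...   | inj₁ (e , _) | inj₂ (f , _) = inj₂ (inj₂ (inj₁ (sym e , sym f)))
      ...   | inj₂ (e , _) | inj₁ (f , _) = inj₂ (inj₂ (inj₂ (sym f , sym e)))
      ...   | inj₂ (e , _) | inj₂ (f , _) = ⊥-elim (b≢ (trans e (sym f)))
      arith : ∀ nu nv xy x y → N ≤ nu + (nv + xy) → xy ≤ x + y → 4 * nu < N → 4 * nv < N →
        4 * x ≤ N → 4 * y ≤ N → ⊥
      arith nu nv xy x y h₁ h₂ h₃ h₄ h₅ h₆ = exceeds 1 (4 ⊛ h₁ ⊕ 4 ⊛ h₂ ⊕ h₃ ⊕ h₄ ⊕ h₅ ⊕ h₆)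
        (solve (N ∷ nu ∷ nv ∷ xy ∷ x ∷ y ∷ []))

  open FindCross using (find-cross)

  -- Equal crosses

  module SameCross {N p q} (C : Config N p q) {R s}
      (X : Cross (Config.rA C) (Config.bA C) (Config.rB C) (Config.bB C) R s)
      (Y : Cross (Config.rB C) (Config.bB C) (Config.rA C) (Config.bA C) R s) where
    open Config C
    module X = Cross X
    module Y = Cross Y

    -- A left vertex off the column `s` is in row `R`, and a right vertex off the row `R` is in
    -- column `s`. They share neither label, so they are not adjacent.
    few-off-row : 4 * count (λ w → ¬? (rB w ≟ R)) < N
    few-off-row = farA C (proj₁ X.offᵇ) (λ w → ¬? (rB w ≟ R)) away
      where
      away : ∀ w → rB w ≢ R → T (adj (proj₁ X.offᵇ) w) → ⊥
      away w r a with edge a | X.on (proj₁ X.offᵇ) | Y.on w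
      ... | _            | inj₂ e | _      = proj₂ X.offᵇ e
      ... | _            | _      | inj₁ e = r e
      ... | inj₁ (e , _) | inj₁ f | inj₂ g = r (trans (sym e) f)
      ... | inj₂ (e , _) | inj₁ f | inj₂ g = proj₂ X.offᵇ (trans e g)

    few-off-col : 4 * count (λ w → ¬? (bB w ≟ s)) < N
    few-off-col = farA C (proj₁ X.offʳ) (λ w → ¬? (bB w ≟ s)) away
      where
      away : ∀ w → bB w ≢ s → T (adj (proj₁ X.offʳ) w) → ⊥
      away w b a with edge a | X.on (proj₁ X.offʳ) | Y.on w
      ... | _            | inj₁ e | _      = proj₂ X.offʳ e
      ... | _            | _      | inj₂ e = b e
      ... | inj₁ (e , _) | inj₂ f | inj₁ g = proj₂ X.offʳ (trans e g)
      ... | inj₂ (e , _) | inj₂ f | inj₁ g = b (trans (sym e) f)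

    -- A free left vertex lies on one arm of the cross. A free neighbour on the other arm would give
    -- an edge of component `R` or `s` that escapes its cover, so all its free neighbours are off
    -- that other arm, where there are fewer than N/4 vertices.
    half-free : 4 * count (freeB? R s) < 2 * N
    half-free with freeA-witness C R s
    ... | u , ¬p , ¬q with rA u ≟ R
    ...   | yes r = half-bound (count (freeB? R s)) (count (λ w → ¬? (bB w ≟ s)))
            (exceptA C u (freeB? R s) (λ w → ¬? (bB w ≟ s)) sees) few-off-col
      where
      sees : ∀ w → ¬ T (PB R w) × ¬ T (QB s w) → T (adj u w) → bB w ≢ s
      sees w (¬p′ , ¬q′) a b with edge a
      ... | inj₁ (e , h) = neither ¬p ¬p′ (h r)
      ... | inj₂ (e , h) = neither ¬q ¬q′ (h (trans e b))
    ...   | no r = half-bound (count (freeB? R s)) (count (λ w → ¬? (rB w ≟ R)))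
            (exceptA C u (freeB? R s) (λ w → ¬? (rB w ≟ R)) sees) few-off-row
      where
      b : bA u ≡ s
      b = [ (λ e → ⊥-elim (r e)) , id ]′ (X.on u)
      sees : ∀ w → ¬ T (PB R w) × ¬ T (QB s w) → T (adj u w) → rB w ≢ R
      sees w (¬p′ , ¬q′) a g with edge a
      ... | inj₁ (e , h) = r (trans e g)
      ... | inj₂ (e , h) = neither ¬q ¬q′ (h b)

  same-cross : ∀ {N p q} (C : Config N p q) {R s} → let open Config C in
    Cross rA bA rB bB R s → Cross rB bB rA bA R s → ⊥
  same-cross {N} C {R} {s} X Y = arith (count (freeA? R s)) (count (freeB? R s)) (freeA+freeB C R s)
    (SameCross.half-free (flip C) Y X) (SameCross.half-free C X Y)
    where
    open Config C
    arith : ∀ x y → N < x + y → 4 * x < 2 * N → 4 * y < 2 * N → ⊥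
    arith x y h₁ h₂ h₃ = exceeds 5 (4 ⊛ h₁ ⊕ h₂ ⊕ h₃) (solve (N ∷ x ∷ y ∷ []))

  -- Crosses with a common row

  module SharedRow {N p q} (C : Config N p q) (2q<N : 2 * q < N) {R s t : L} (s≢t : s ≢ t)
      (onA : ∀ u → Config.rA C u ≡ R ⊎ Config.bA C u ≡ s) (offA : ∃ λ u → Config.rA C u ≢ R)
      (onB : ∀ w → Config.rB C w ≡ R ⊎ Config.bB C w ≡ t) (offB : ∃ λ w → Config.rB C w ≢ R)
      (a′≤b′ : count (λ u → ¬? (Config.rA C u ≟ R)) ≤ count (λ w → ¬? (Config.rB C w ≟ R)))
      where
    open Config C

    -- Off the row R the left vertices lie in column s and the right ones in column t;
    -- Ax and Bx collect the exceptional cells of row R, which miss one of these two sets.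
    A′? = λ u → ¬? (rA u ≟ R)
    B′? = λ w → ¬? (rB w ≟ R)
    At? = λ u → (rA u ≟ R) ×-dec (bA u ≟ t)
    Ax? = λ u → (rA u ≟ R) ×-dec ¬? (bA u ≟ t)
    Bs? = λ w → (rB w ≟ R) ×-dec (bB w ≟ s)
    Bx? = λ w → (rB w ≟ R) ×-dec ¬? (bB w ≟ s)

    a = count At?
    a′ = count A′?
    aˣ = count Ax?
    b = count Bs?
    b′ = count B′?
    bˣ = count Bx?

    colA : ∀ {u} → rA u ≢ R → bA u ≡ s
    colA {u} r = [ (λ e → ⊥-elim (r e)) , id ]′ (onA u)

    colB : ∀ {w} → rB w ≢ R → bB w ≡ t
    colB {w} r = [ (λ e → ⊥-elim (r e)) , id ]′ (onB w)

    totalA : N ≤ a + (aˣ + a′)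
    totalA = count-cover₃ At? Ax? A′? λ u → dec-cases (rA u ≟ R) (bA u ≟ t)

    totalB : N ≤ b + (bˣ + b′)
    totalB = count-cover₃ Bs? Bx? B′? λ w → dec-cases (rB w ≟ R) (bB w ≟ s)

    Ax-far-B′ : ∀ {u w} → rA u ≡ R × bA u ≢ t → rB w ≢ R → T (adj u w) → ⊥
    Ax-far-B′ (r , b≢) r′ e with edge e
    ... | inj₁ (f , _) = r′ (trans (sym f) r)
    ... | inj₂ (f , _) = b≢ (trans f (colB r′))

    Bx-far-A′ : ∀ {u w} → rA u ≢ R → rB w ≡ R × bB w ≢ s → T (adj u w) → ⊥
    Bx-far-A′ r′ (r , b≢) e with edge e
    ... | inj₁ (f , _) = r′ (trans f r)
    ... | inj₂ (f , _) = b≢ (trans (sym f) (colA r′))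

    few-Ax : 4 * aˣ < N
    few-Ax = farB C (proj₁ offB) Ax? λ u x → Ax-far-B′ x (proj₂ offB)

    few-Bx : 4 * bˣ < N
    few-Bx = farA C (proj₁ offA) Bx? λ w x → Bx-far-A′ (proj₂ offA) x

    few-B′ : ∀ u → rA u ≡ R × bA u ≢ t → 4 * b′ < N
    few-B′ u x = farA C u B′? λ w → Ax-far-B′ x

    few-A′ : 4 * b′ < N → 4 * a′ < N
    few-A′ h = ≤-trans (s≤s (4 ⊛ a′≤b′)) h

    module UncoveredB′ (w₀ : Fin N) (w₀∈ : rB w₀ ≢ R) (w₀∉Q : ¬ T (QB t w₀)) where

      -- `w₀` sees nothing of `X` and `u₀` nothing of `Y`, so each has fewer than N/4 elements. The
      -- left vertices of row `R` outside `X` and those of `B′?` outside `Y` lie in the cover `Q t`.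
      -- With `a′ ≤ b′` this gives N at most |X| + |Y| + q, which is below N.
      uncovered-At : ∀ u₀ → rA u₀ ≡ R → bA u₀ ≡ t → ¬ T (QA t u₀) → ⊥
      uncovered-At u₀ r c u₀∉Q = arith (count X?) (count Y?) a′ b′ (count (T? ∘ QA t)) (count (T? ∘ QB t))
          (count-cover₃ X? (T? ∘ QA t) A′? splitA) (count-∪ B′? Y? (T? ∘ QB t) (λ w → dec-remove (T? (QB t w))))
          (farB C w₀ X? farX) (farA C u₀ Y? farY) a′≤b′ (sizeQ t) 2q<N
        where
        X? = λ u → (rA u ≟ R) ×-dec (¬? (bA u ≟ t) ⊎-dec ¬? (T? (QA t u)))
        Y? = λ w → ¬? (rB w ≟ R) ×-dec ¬? (T? (QB t w))
        splitA : ∀ u → (rA u ≡ R × (bA u ≢ t ⊎ ¬ T (QA t u))) ⊎ T (QA t u) ⊎ rA u ≢ R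
        splitA u with rA u ≟ R | T? (QA t u)
        ... | no ¬r  | _      = inj₂ (inj₂ ¬r)
        ... | yes r′ | yes x  = inj₂ (inj₁ x)
        ... | yes r′ | no ¬x  = inj₁ (r′ , inj₂ ¬x)
        farX : ∀ u → rA u ≡ R × (bA u ≢ t ⊎ ¬ T (QA t u)) → T (adj u w₀) → ⊥
        farX u (r′ , x) e with edge e | x
        ... | inj₁ (f , _) | _       = w₀∈ (trans (sym f) r′)
        ... | inj₂ (f , _) | inj₁ c≢ = c≢ (trans f (colB w₀∈))
        ... | inj₂ (f , h) | inj₂ ¬x = neither ¬x w₀∉Q (h (trans f (colB w₀∈)))
        farY : ∀ w → rB w ≢ R × ¬ T (QB t w) → T (adj u₀ w) → ⊥
        farY w (r′ , ¬x) e with edge e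
        ... | inj₁ (f , _) = r′ (trans (sym f) r)
        ... | inj₂ (f , h) = neither u₀∉Q ¬x (h c)
        arith : ∀ x y a′ b′ qa qb → N ≤ x + (qa + a′) → b′ ≤ y + qb → 4 * x < N → 4 * y < N →
          a′ ≤ b′ → qa + qb ≤ q → 2 * q < N → ⊥
        arith x y a′ b′ qa qb h₁ h₂ h₃ h₄ h₅ h₆ h₇ =
          exceeds 3 (4 ⊛ h₁ ⊕ 4 ⊛ h₂ ⊕ h₃ ⊕ h₄ ⊕ 4 ⊛ h₅ ⊕ 4 ⊛ h₆ ⊕ 2 ⊛ h₇)
            (solve (N ∷ q ∷ x ∷ y ∷ a′ ∷ b′ ∷ qa ∷ qb ∷ []))

      module CoveredAt (covered : ∀ u → rA u ≡ R × bA u ≡ t → T (QA t u)) where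

        a≤q : a ≤ q
        a≤q = ≤-trans (count-mono At? (T? ∘ QA t) covered)
          (≤-trans (m≤m+n (count (T? ∘ QA t)) (count (T? ∘ QB t))) (sizeQ t))

        -- A vertex of `Ax?` sees none of `B′?`, so `b′`, and with it `a′`, is below N/4. Then `a`
        -- exceeds N/2, against `a ≤ q`.
        no-Ax : ∀ u → ¬ (rA u ≡ R × bA u ≢ t)
        no-Ax u x = arith a aˣ a′ totalA a≤q few-Ax (few-A′ (few-B′ u x)) 2q<N
          where
          arith : ∀ a e a′ → N ≤ a + (e + a′) → a ≤ q → 4 * e < N → 4 * a′ < N → 2 * q < N → ⊥
          arith a e a′ h₁ h₂ h₃ h₄ h₅ = exceeds 3 (4 ⊛ h₁ ⊕ 4 ⊛ h₂ ⊕ h₃ ⊕ h₄ ⊕ 2 ⊛ h₅)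
            (solve (N ∷ q ∷ a ∷ e ∷ a′ ∷ []))

        a′-big : N < 2 * a′
        a′-big = arith a aˣ a′ totalA a≤q (≤-reflexive (count-empty Ax? no-Ax)) 2q<N
          where
          arith : ∀ a e a′ → N ≤ a + (e + a′) → a ≤ q → e ≤ 0 → 2 * q < N → N < 2 * a′
          arith a e a′ h₁ h₂ h₃ h₄ = ≰⇒> λ (h₅ : 2 * a′ ≤ N) →
            exceeds 0 (2 ⊛ h₁ ⊕ 2 ⊛ h₂ ⊕ 2 ⊛ h₃ ⊕ h₄ ⊕ h₅) (solve (N ∷ q ∷ a ∷ e ∷ a′ ∷ []))

        b′-big : N < 2 * b′
        b′-big = ≤-trans a′-big (2 ⊛ a′≤b′)

        -- Off row `R` the columns `s` and `t` differ, so edges there need a common row. If `u` and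
        -- `v` had different rows, each vertex of `B′?` would be missed by one of them, giving `b′`
        -- below N/2.
        A′-one-row : ∀ u v → rA u ≢ R → rA v ≢ R → rA u ≡ rA v
        A′-one-row u v u∈ v∈ with rA u ≟ rA v
        ... | yes e = e
        ... | no ¬e = ⊥-elim (arith b′ (count (Z? u)) (count (Z? v))
            (count-∪ B′? (Z? u) (Z? v) split) (farA C u (Z? u) (farZ u u∈)) (farA C v (Z? v) (farZ v v∈)) b′-big)
          where
          Z? = λ z w → ¬? (rB w ≟ R) ×-dec ¬? (rA z ≟ rB w)
          split : ∀ w → rB w ≢ R → (rB w ≢ R × rA u ≢ rB w) ⊎ (rB w ≢ R × rA v ≢ rB w)
          split w r with rA u ≟ rB w
          ... | no x  = inj₁ (r , x)
          ... | yes x = inj₂ (r , λ y → ¬e (trans x (sym y)))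
          farZ : ∀ z → rA z ≢ R → ∀ w → rB w ≢ R × rA z ≢ rB w → T (adj z w) → ⊥
          farZ z z∈ w (r , x) e with edge e
          ... | inj₁ (f , _) = x f
          ... | inj₂ (f , _) = s≢t (trans (sym (colA z∈)) (trans f (colB r)))
          arith : ∀ b x y → b ≤ x + y → 4 * x < N → 4 * y < N → N < 2 * b → ⊥
          arith b x y h₁ h₂ h₃ h₄ = exceeds 3 (4 ⊛ h₁ ⊕ h₂ ⊕ h₃ ⊕ 2 ⊛ h₄) (solve (N ∷ b ∷ x ∷ y ∷ []))

        module Row (u′ : Fin N) (u′∈ : rA u′ ≢ R) where
          k = rA u′

          rowA : ∀ {u} → rA u ≢ R → rA u ≡ k
          rowA {u} u∈ = A′-one-row u u′ u∈ u′∈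

          free⊆A′ : ∀ u → ¬ T (PA k u) × ¬ T (QA t u) → rA u ≢ R
          free⊆A′ u (_ , ¬x) r with bA u ≟ t
          ... | yes c = ¬x (covered u (r , c))
          ... | no c≢ = no-Ax u (r , c≢)

          V? = λ w → freeB? k t w ×-dec ¬? (rB w ≟ R)
          BR? = λ w → rB w ≟ R

          sealed : ∀ {u w} → ¬ T (PA k u) × ¬ T (QA t u) → (¬ T (PB k w) × ¬ T (QB t w)) × rB w ≢ R →
            T (adj u w) → ⊥
          sealed {u} f ((¬p , _) , w∈) e with edge e
          ... | inj₁ (_ , h) = neither (proj₁ f) ¬p (h (rowA (free⊆A′ u f)))
          ... | inj₂ (g , _) = s≢t (trans (sym (colA (free⊆A′ u f))) (trans g (colB w∈)))

          fb≤ : count (freeB? k t) ≤ count V? + count BR?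
          fb≤ = count-∪ (freeB? k t) V? BR? λ w → dec-remove (rB w ≟ R)

          BR+b′≤N : count BR? + b′ ≤ N
          BR+b′≤N = ≤-trans (count-⊎ (all-of N) BR? B′? _ _ (λ w r ¬r → ¬r r)) (≤-reflexive (count-full (all-of N) _))

          -- At most `a′ ≤ b′` left vertices are free, so more than N - `b′` right ones are. They do
          -- not all fit into row `R`.
          V-witness : ∃ λ w → (¬ T (PB k w) × ¬ T (QB t w)) × rB w ≢ R
          V-witness = count-witness V? (arith (count (freeA? k t)) (count (freeB? k t)) (count V?) (count BR?) a′ b′
              (freeA+freeB C k t) fb≤ (count-mono (freeA? k t) A′? free⊆A′) BR+b′≤N a′≤b′)
            where
            arith : ∀ fa fb v r a′ b′ → N < fa + fb → fb ≤ v + r → fa ≤ a′ → r + b′ ≤ N → a′ ≤ b′ → 0 < v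
            arith fa fb v r a′ b′ h₁ h₂ h₃ h₄ h₅ = ≰⇒> λ (h₆ : v ≤ 0) →
              exceeds 0 (h₁ ⊕ h₂ ⊕ h₃ ⊕ h₄ ⊕ h₅ ⊕ h₆) (solve (N ∷ fa ∷ fb ∷ v ∷ r ∷ a′ ∷ b′ ∷ []))

          -- By `sealed`, the free left vertices and those counted by `V?` span no edge, so each set
          -- is below N/4. The remaining free right vertices lie in row `R`, which holds fewer than
          -- N/2 since `b′` is above N/2.
          impossible : ⊥
          impossible = arith (count (freeA? k t)) (count (freeB? k t)) (count V?) (count BR?) b′
              (freeA+freeB C k t) fb≤ BR+b′≤N b′-big
              (farB C (proj₁ V-witness) (freeA? k t) (λ u f → sealed f (proj₂ V-witness)))
              (farA C (proj₁ u₁) V? (λ w f → sealed (proj₂ u₁) f))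
            where
            u₁ = freeA-witness C k t
            arith : ∀ fa fb v r b′ → N < fa + fb → fb ≤ v + r → r + b′ ≤ N → N < 2 * b′ →
              4 * fa < N → 4 * v < N → ⊥
            arith fa fb v r b′ h₁ h₂ h₃ h₄ h₅ h₆ =
              exceeds 7 (4 ⊛ h₁ ⊕ 4 ⊛ h₂ ⊕ 4 ⊛ h₃ ⊕ 2 ⊛ h₄ ⊕ h₅ ⊕ h₆) (solve (N ∷ fa ∷ fb ∷ v ∷ r ∷ b′ ∷ []))

      impossible : ⊥
      impossible with search (λ u → ((rA u ≟ R) ×-dec (bA u ≟ t)) ×-dec ¬? (T? (QA t u)))
      ... | inj₁ (u₀ , (r , c) , ¬x) = uncovered-At u₀ r c ¬x
      ... | inj₂ none = CoveredAt.Row.impossible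
              (λ u x → decidable-stable (T? (QA t u)) (λ ¬x → none u (x , ¬x))) (proj₁ offA) (proj₂ offA)

    module CoveredB′ (covered : ∀ w → rB w ≢ R → T (QB t w)) where

      b′≤qb : b′ ≤ count (T? ∘ QB t)
      b′≤qb = count-mono B′? (T? ∘ QB t) covered

      b′≤q : b′ ≤ q
      b′≤q = ≤-trans b′≤qb (≤-trans (m≤n+m (count (T? ∘ QB t)) (count (T? ∘ QA t))) (sizeQ t))

      a-big : N < 2 * a
      a-big with search Ax?
      ... | inj₁ (u , x) = arith a aˣ a′ totalA few-Ax (few-A′ (few-B′ u x))
        where
        arith : ∀ a e a′ → N ≤ a + (e + a′) → 4 * e < N → 4 * a′ < N → N < 2 * a
        arith a e a′ h₁ h₂ h₃ = ≰⇒> λ (h₄ : 2 * a ≤ N) → exceeds 1 (4 ⊛ h₁ ⊕ h₂ ⊕ h₃ ⊕ 2 ⊛ h₄)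
          (solve (N ∷ a ∷ e ∷ a′ ∷ []))
      ... | inj₂ none = arith a aˣ a′ b′ totalA (≤-reflexive (count-empty Ax? none)) a′≤b′ b′≤q 2q<N
        where
        arith : ∀ a e a′ b′ → N ≤ a + (e + a′) → e ≤ 0 → a′ ≤ b′ → b′ ≤ q → 2 * q < N → N < 2 * a
        arith a e a′ b′ h₁ h₂ h₃ h₄ h₅ = ≰⇒> λ (h₆ : 2 * a ≤ N) →
          exceeds 0 (2 ⊛ h₁ ⊕ 2 ⊛ h₂ ⊕ 2 ⊛ h₃ ⊕ 2 ⊛ h₄ ⊕ h₅ ⊕ h₆) (solve (N ∷ q ∷ a ∷ e ∷ a′ ∷ b′ ∷ []))

      As? = λ u → bA u ≟ s

      a+As≤N : a + count As? ≤ N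
      a+As≤N = ≤-trans (count-⊎ (all-of N) At? As? _ _ (λ u x y → s≢t (trans (sym y) (proj₂ x))))
        (≤-reflexive (count-full (all-of N) _))

      freeB-row : ∀ {w} → ¬ T (PB R w) × ¬ T (QB t w) → rB w ≡ R
      freeB-row {w} f = decidable-stable (rB w ≟ R) λ r → proj₂ f (covered w r)

      FA = count (freeA? R t)
      FB = count (freeB? R t)

      -- Free right vertices lie in row `R`, so edges between free vertices are blue and outside
      -- column `t`. If `u` were off column `s`, its free neighbours would be in `Bx?`, leaving
      -- fewer than N/2 free right vertices. A free right vertex off column `s` would likewise see
      -- only `Ax?`, leaving too few free left vertices. Hence all free right vertices are in column
      -- `s`: `u` sees none of them, and each sees only free vertices of column `s`, which has fewer
      -- than N/2 left vertices.
      freeA-col : ∀ u → ¬ T (PA R u) × ¬ T (QA t u) → bA u ≡ s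
      freeA-col u f with rA u ≟ R
      ... | no r = colA r
      ... | yes r with bA u ≟ s
      ...   | yes c = c
      ...   | no c≢ = ⊥-elim (arith FA FB (count As?) a (freeA+freeB C R t)
                (exceptB C (proj₁ w₁) (freeA? R t) As? seesA) (farA C u (freeB? R t) farU) a+As≤N a-big)
        where
        blue-only : ∀ {v w} → ¬ T (PA R v) × ¬ T (QA t v) → ¬ T (PB R w) × ¬ T (QB t w) → T (adj v w) →
          bA v ≡ bB w × bA v ≢ t
        blue-only fv fw e with edge e
        ... | inj₁ (g , h) = ⊥-elim (neither (proj₁ fv) (proj₁ fw) (h (trans g (freeB-row fw))))
        ... | inj₂ (g , h) = g , λ x → neither (proj₂ fv) (proj₂ fw) (h x)
        fb-half : 4 * FB < 2 * N
        fb-half = half-bound FB bˣ (exceptA C u (freeB? R t) Bx?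
            (λ w fw e → freeB-row fw , λ x → c≢ (trans (proj₁ (blue-only f fw e)) x))) few-Bx
        freeB-col : ∀ w → ¬ T (PB R w) × ¬ T (QB t w) → bB w ≡ s
        freeB-col w fw with bB w ≟ s
        ... | yes d = d
        ... | no d≢ = ⊥-elim (arith₂ FA FB aˣ (freeA+freeB C R t) fb-half
            (exceptB C w (freeA? R t) Ax? sees) few-Ax)
          where
          sees : ∀ v → ¬ T (PA R v) × ¬ T (QA t v) → T (adj v w) → rA v ≡ R × bA v ≢ t
          sees v fv e = decidable-stable (rA v ≟ R)
              (λ r′ → d≢ (trans (sym (proj₁ (blue-only fv fw e))) (colA r′)))
            , proj₂ (blue-only fv fw e)
          arith₂ : ∀ x y e → N < x + y → 4 * y < 2 * N → 4 * x < N + 4 * e → 4 * e < N → ⊥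
          arith₂ x y e h₁ h₂ h₃ h₄ = exceeds 6 (4 ⊛ h₁ ⊕ h₂ ⊕ h₃ ⊕ h₄) (solve (N ∷ x ∷ y ∷ e ∷ []))
        w₁ = freeB-witness C R t
        farU : ∀ w → ¬ T (PB R w) × ¬ T (QB t w) → T (adj u w) → ⊥
        farU w fw e = c≢ (trans (proj₁ (blue-only f fw e)) (freeB-col w fw))
        seesA : ∀ v → ¬ T (PA R v) × ¬ T (QA t v) → T (adj v (proj₁ w₁)) → bA v ≡ s
        seesA v fv e = trans (proj₁ (blue-only fv (proj₂ w₁) e)) (freeB-col (proj₁ w₁) (proj₂ w₁))
        arith : ∀ x y σ a → N < x + y → 4 * x < N + 4 * σ → 4 * y < N → a + σ ≤ N → N < 2 * a → ⊥
        arith x y σ a h₁ h₂ h₃ h₄ h₅ = exceeds 7 (4 ⊛ h₁ ⊕ h₂ ⊕ h₃ ⊕ 4 ⊛ h₄ ⊕ 2 ⊛ h₅)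
          (solve (N ∷ x ∷ y ∷ σ ∷ a ∷ []))

      -- The free left vertices would all lie off row `R` while the free right ones lie in it: at
      -- most `a′` plus N - `b′`, hence at most N.
      no-A-Rs : (∀ u → ¬ (rA u ≡ R × bA u ≡ s)) → ⊥
      no-A-Rs none = arith FA FB a′ b′ (freeA+freeB C R t)
          (count-mono (freeA? R t) A′? (λ u f r → none u (r , freeA-col u f)))
          (≤-trans (count-⊎ (all-of N) (freeB? R t) B′? _ _ (λ w f r → r (freeB-row f)))
            (≤-reflexive (count-full (all-of N) _))) a′≤b′
        where
        arith : ∀ x y a′ b′ → N < x + y → x ≤ a′ → y + b′ ≤ N → a′ ≤ b′ → ⊥
        arith x y a′ b′ h₁ h₂ h₃ h₄ = exceeds 0 (h₁ ⊕ h₂ ⊕ h₃ ⊕ h₄) (solve (N ∷ x ∷ y ∷ a′ ∷ b′ ∷ []))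

      module SomeARs (u* : Fin N) (r* : rA u* ≡ R) (c* : bA u* ≡ s) where

        b′-few : 4 * b′ < N
        b′-few = few-B′ u* (r* , λ e → s≢t (trans (sym c*) e))

        b-big : N < 2 * b
        b-big = arith b bˣ b′ totalB few-Bx b′-few
          where
          arith : ∀ b e b′ → N ≤ b + (e + b′) → 4 * e < N → 4 * b′ < N → N < 2 * b
          arith b e b′ h₁ h₂ h₃ = ≰⇒> λ (h₄ : 2 * b ≤ N) → exceeds 1 (4 ⊛ h₁ ⊕ h₂ ⊕ h₃ ⊕ 2 ⊛ h₄)
            (solve (N ∷ b ∷ e ∷ b′ ∷ []))

        At⊆P∪Q : ∀ u → rA u ≡ R × bA u ≡ t → T (PA R u) ⊎ T (QA t u)
        At⊆P∪Q u (_ , c) with T? (PA R u) | T? (QA t u)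
        ... | yes x | _     = inj₁ x
        ... | no _  | yes x = inj₂ x
        ... | no x  | no y  = ⊥-elim (s≢t (trans (sym (freeA-col u (x , y))) c))

        -- `u₀` sees nothing of `Y`. So the covers `P R` and `Q t` contain all but `Bx?` and `Y` on
        -- the right, more than N/2 vertices, and on the left they contain `At?`, again more than
        -- N/2; together this exceeds `p + q`.
        uncovered-At : ∀ u₀ → rA u₀ ≡ R → bA u₀ ≡ t → ¬ T (PA R u₀) → ⊥
        uncovered-At u₀ r c ¬p = arith a b b′ bˣ (count Y?)
            (count (T? ∘ PA R)) (count (T? ∘ PB R)) (count (T? ∘ QA t)) (count (T? ∘ QB t))
            (count-∪ At? (T? ∘ PA R) (T? ∘ QA t) At⊆P∪Q) (count-∪ Bs? Y? (T? ∘ PB R) (λ w → dec-remove (T? (PB R w)))) b′≤qb totalB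
            few-Bx (farA C u₀ Y? far) a-big (sizeP R) (sizeQ t) p+q<N
          where
          Y? = λ w → Bs? w ×-dec ¬? (T? (PB R w))
          far : ∀ w → (rB w ≡ R × bB w ≡ s) × ¬ T (PB R w) → T (adj u₀ w) → ⊥
          far w ((_ , d) , ¬p′) e with edge e
          ... | inj₁ (_ , h) = neither ¬p ¬p′ (h r)
          ... | inj₂ (f , _) = s≢t (trans (sym d) (trans (sym f) c))
          arith : ∀ a b b′ e y pa pb qa qb → a ≤ pa + qa → b ≤ y + pb → b′ ≤ qb → N ≤ b + (e + b′) →
            4 * e < N → 4 * y < N → N < 2 * a → pa + pb ≤ p → qa + qb ≤ q → p + q < N → ⊥
          arith a b b′ e y pa pb qa qb h₁ h₂ h₃ h₄ h₅ h₆ h₇ h₈ h₉ h₁₀ =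
            exceeds 7 (4 ⊛ h₁ ⊕ 4 ⊛ h₂ ⊕ 4 ⊛ h₃ ⊕ 4 ⊛ h₄ ⊕ h₅ ⊕ h₆ ⊕ 2 ⊛ h₇ ⊕ 4 ⊛ h₈ ⊕ 4 ⊛ h₉ ⊕ 4 ⊛ h₁₀)
              (solve (N ∷ p ∷ q ∷ a ∷ b ∷ b′ ∷ e ∷ y ∷ pa ∷ pb ∷ qa ∷ qb ∷ []))

        module AtInP (inP : ∀ u → rA u ≡ R × bA u ≡ t → T (PA R u)) where

          -- The free neighbours of a free left vertex are off row `R` if it is itself off that row,
          -- and in `Bx?` otherwise. In the latter case a neighbour off row `R` would put the vertex
          -- into column `t`, hence into `P R` by `inP`.
          freeB-half : 4 * count (freeB? R s) < 2 * N
          freeB-half with freeA-witness C R s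
          ... | u , ¬p , ¬q with rA u ≟ R
          ...   | no r = half-bound (count (freeB? R s)) b′ (exceptA C u (freeB? R s) B′? sees) b′-few
            where
            sees : ∀ w → ¬ T (PB R w) × ¬ T (QB s w) → T (adj u w) → rB w ≢ R
            sees w (_ , ¬q′) e r′ with edge e
            ... | inj₁ (f , _) = r (trans f r′)
            ... | inj₂ (_ , h) = neither ¬q ¬q′ (h (colA r))
          ...   | yes r = half-bound (count (freeB? R s)) bˣ (exceptA C u (freeB? R s) Bx? sees) few-Bx
            where
            sees : ∀ w → ¬ T (PB R w) × ¬ T (QB s w) → T (adj u w) → rB w ≡ R × bB w ≢ s
            sees w (¬p′ , ¬q′) e with edge e
            ... | inj₁ (_ , h) = ⊥-elim (neither ¬p ¬p′ (h r))
            ... | inj₂ (f , h) = decidable-stable (rB w ≟ R) (λ r′ → ¬p (inP u (r , trans f (colB r′))))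
                               , λ d → neither ¬q ¬q′ (h (trans f d))

          Bs⊆P∪Q : ∀ w → rB w ≡ R × bB w ≡ s → T (PB R w) ⊎ T (QB s w)
          Bs⊆P∪Q w (r , d) with T? (PB R w) | T? (QB s w)
          ... | yes x | _     = inj₁ x
          ... | no _  | yes x = inj₂ x
          ... | no ¬p′ | no ¬q′ = ⊥-elim (arith (count (freeA? R s)) (count (freeB? R s)) (freeA+freeB C R s)
              freeB-half (farB C w (freeA? R s) far))
            where
            far : ∀ u → ¬ T (PA R u) × ¬ T (QA s u) → T (adj u w) → ⊥
            far u (¬p , ¬q) e with edge e
            ... | inj₁ (f , h) = neither ¬p ¬p′ (h (trans f r))
            ... | inj₂ (f , h) = neither ¬q ¬q′ (h (trans f d))
            arith : ∀ x y → N < x + y → 4 * y < 2 * N → 4 * x < N → ⊥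
            arith x y h₁ h₂ h₃ = exceeds (5 + N) (4 ⊛ h₁ ⊕ h₂ ⊕ h₃) (solve (N ∷ x ∷ y ∷ []))

          impossible : ⊥
          impossible = arith a b (count (T? ∘ PA R)) (count (T? ∘ PB R)) (count (T? ∘ QA s)) (count (T? ∘ QB s))
              (count-mono At? (T? ∘ PA R) inP) (count-∪ Bs? (T? ∘ PB R) (T? ∘ QB s) Bs⊆P∪Q)
              a-big b-big (sizeP R) (sizeQ s) p+q<N
            where
            arith : ∀ a b pa pb qa qb → a ≤ pa → b ≤ pb + qb → N < 2 * a → N < 2 * b →
              pa + pb ≤ p → qa + qb ≤ q → p + q < N → ⊥
            arith a b pa pb qa qb h₁ h₂ h₃ h₄ h₅ h₆ h₇ =
              exceeds (3 + 2 * qa) (2 ⊛ h₁ ⊕ 2 ⊛ h₂ ⊕ h₃ ⊕ h₄ ⊕ 2 ⊛ h₅ ⊕ 2 ⊛ h₆ ⊕ 2 ⊛ h₇)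
                (solve (N ∷ p ∷ q ∷ a ∷ b ∷ pa ∷ pb ∷ qa ∷ qb ∷ []))

        impossible : ⊥
        impossible with search (λ u → At? u ×-dec ¬? (T? (PA R u)))
        ... | inj₁ (u₀ , (r , c) , ¬p) = uncovered-At u₀ r c ¬p
        ... | inj₂ none = AtInP.impossible λ u x → decidable-stable (T? (PA R u)) λ ¬x → none u (x , ¬x)

      impossible : ⊥
      impossible with search (λ u → (rA u ≟ R) ×-dec (bA u ≟ s))
      ... | inj₁ (u* , r* , c*) = SomeARs.impossible u* r* c*
      ... | inj₂ none = no-A-Rs none

    impossible : ⊥
    impossible with search (λ w → ¬? (rB w ≟ R) ×-dec ¬? (T? (QB t w)))
    ... | inj₁ (w₀ , w₀∈ , w₀∉) = UncoveredB′.impossible w₀ w₀∈ w₀∉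
    ... | inj₂ none = CoveredB′.impossible λ w r → decidable-stable (T? (QB t w)) λ ¬x → none w (r , ¬x)

  shared-row : ∀ {N p q} (C : Config N p q) → 2 * q < N → ∀ {R s t} → s ≢ t → let open Config C in
    (∀ u → rA u ≡ R ⊎ bA u ≡ s) → (∃ λ u → rA u ≢ R) →
    (∀ w → rB w ≡ R ⊎ bB w ≡ t) → (∃ λ w → rB w ≢ R) → ⊥
  shared-row C 2q<N {R} s≢t onA offA onB offB
    with ≤-total (count (λ u → ¬? (Config.rA C u ≟ R))) (count (λ w → ¬? (Config.rB C w ≟ R)))
  ... | inj₁ a′≤b′ = SharedRow.impossible C 2q<N s≢t onA offA onB offB a′≤b′
  ... | inj₂ b′≤a′ = SharedRow.impossible (flip C) 2q<N (λ e → s≢t (sym e)) onB offB onA offA b′≤a′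

  -- Crosses with a common column

  module SharedCol {N p q} (C : Config N p q) (2q<N : 2 * q < N) {R k s : L} (k≢R : k ≢ R)
      (onA : ∀ u → Config.rA C u ≡ R ⊎ Config.bA C u ≡ s) (offA : ∃ λ u → Config.bA C u ≢ s)
      (onB : ∀ w → Config.rB C w ≡ k ⊎ Config.bB C w ≡ s) (offB : ∃ λ w → Config.bB C w ≢ s)
      (atB : ∃ λ w → Config.rB C w ≡ R × Config.bB C w ≡ s)
      (a′≤b′ : count (λ u → ¬? (Config.bA C u ≟ s)) ≤ count (λ w → ¬? (Config.bB C w ≟ s)))
      where
    open Config C

    A′? = λ u → ¬? (bA u ≟ s)
    B′? = λ w → ¬? (bB w ≟ s)
    Ak? = λ u → (bA u ≟ s) ×-dec (rA u ≟ k)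
    Ax? = λ u → (bA u ≟ s) ×-dec ¬? (rA u ≟ k)
    BR? = λ w → (bB w ≟ s) ×-dec (rB w ≟ R)
    Bx? = λ w → (bB w ≟ s) ×-dec ¬? (rB w ≟ R)

    a = count Ak?
    a′ = count A′?
    aˣ = count Ax?
    b = count BR?
    b′ = count B′?
    bˣ = count Bx?

    rowA : ∀ {u} → bA u ≢ s → rA u ≡ R
    rowA {u} c = [ id , (λ e → ⊥-elim (c e)) ]′ (onA u)

    rowB : ∀ {w} → bB w ≢ s → rB w ≡ k
    rowB {w} c = [ id , (λ e → ⊥-elim (c e)) ]′ (onB w)

    totalA : N ≤ a + (aˣ + a′)
    totalA = count-cover₃ Ak? Ax? A′? λ u → dec-cases (bA u ≟ s) (rA u ≟ k)

    totalB : N ≤ b + (bˣ + b′)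
    totalB = count-cover₃ BR? Bx? B′? λ w → dec-cases (bB w ≟ s) (rB w ≟ R)

    Ax-far-B′ : ∀ {u w} → bA u ≡ s × rA u ≢ k → bB w ≢ s → T (adj u w) → ⊥
    Ax-far-B′ (c , r≢) c′ e with edge e
    ... | inj₁ (f , _) = r≢ (trans f (rowB c′))
    ... | inj₂ (f , _) = c′ (trans (sym f) c)

    Bx-far-A′ : ∀ {u w} → bA u ≢ s → bB w ≡ s × rB w ≢ R → T (adj u w) → ⊥
    Bx-far-A′ c′ (c , r≢) e with edge e
    ... | inj₁ (f , _) = r≢ (trans (sym f) (rowA c′))
    ... | inj₂ (f , _) = c′ (trans f c)

    few-Ax : 4 * aˣ < N
    few-Ax = farB C (proj₁ offB) Ax? λ u x → Ax-far-B′ x (proj₂ offB)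

    few-Bx : 4 * bˣ < N
    few-Bx = farA C (proj₁ offA) Bx? λ w x → Bx-far-A′ (proj₂ offA) x

    qa = count (T? ∘ QA s)
    qb = count (T? ∘ QB s)

    -- Ak and BR are joined by blue edges of the component s only.
    both-big : N < 2 * a → N < 2 * b → ⊥
    both-big a-big b-big with search X? | search Y?
      where
      X? = λ u → Ak? u ×-dec ¬? (T? (QA s u))
      Y? = λ w → BR? w ×-dec ¬? (T? (QB s w))
    ... | inj₂ none | _ = arith a qa qb a-big
        (count-mono Ak? (T? ∘ QA s) λ u x → decidable-stable (T? (QA s u)) λ ¬x → none u (x , ¬x)) (sizeQ s) 2q<N
      where
      arith : ∀ a qa qb → N < 2 * a → a ≤ qa → qa + qb ≤ q → 2 * q < N → ⊥
      arith a qa qb h₁ h₂ h₃ h₄ = exceeds (1 + 2 * qb) (h₁ ⊕ 2 ⊛ h₂ ⊕ 2 ⊛ h₃ ⊕ h₄) (solve (N ∷ q ∷ a ∷ qa ∷ qb ∷ []))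
    ... | inj₁ _ | inj₂ none = arith b qa qb b-big
        (count-mono BR? (T? ∘ QB s) λ w x → decidable-stable (T? (QB s w)) λ ¬x → none w (x , ¬x)) (sizeQ s) 2q<N
      where
      arith : ∀ b qa qb → N < 2 * b → b ≤ qb → qa + qb ≤ q → 2 * q < N → ⊥
      arith b qa qb h₁ h₂ h₃ h₄ = exceeds (1 + 2 * qa) (h₁ ⊕ 2 ⊛ h₂ ⊕ 2 ⊛ h₃ ⊕ h₄) (solve (N ∷ q ∷ b ∷ qa ∷ qb ∷ []))
    ... | inj₁ (u₀ , x₀) | inj₁ (w₀ , y₀) = arith a b (count X?) (count Y?) qa qb
        (count-∪ Ak? X? (T? ∘ QA s) λ u → dec-remove (T? (QA s u)))
        (count-∪ BR? Y? (T? ∘ QB s) λ w → dec-remove (T? (QB s w)))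
        (farB C w₀ X? (λ u x → far x y₀)) (farA C u₀ Y? (λ w y → far x₀ y)) a-big b-big (sizeQ s) 2q<N
      where
      X? = λ u → Ak? u ×-dec ¬? (T? (QA s u))
      Y? = λ w → BR? w ×-dec ¬? (T? (QB s w))
      far : ∀ {u w} → (bA u ≡ s × rA u ≡ k) × ¬ T (QA s u) → (bB w ≡ s × rB w ≡ R) × ¬ T (QB s w) →
        T (adj u w) → ⊥
      far ((c , r) , ¬x) ((_ , r′) , ¬y) e with edge e
      ... | inj₁ (f , _) = k≢R (trans (sym r) (trans f r′))
      ... | inj₂ (_ , h) = neither ¬x ¬y (h c)
      arith : ∀ a b x y qa qb → a ≤ x + qa → b ≤ y + qb → 4 * x < N → 4 * y < N → N < 2 * a → N < 2 * b →
        qa + qb ≤ q → 2 * q < N → ⊥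
      arith a b x y qa qb h₁ h₂ h₃ h₄ h₅ h₆ h₇ h₈ =
        exceeds 7 (4 ⊛ h₁ ⊕ 4 ⊛ h₂ ⊕ h₃ ⊕ h₄ ⊕ 2 ⊛ h₅ ⊕ 2 ⊛ h₆ ⊕ 4 ⊛ h₇ ⊕ 2 ⊛ h₈)
          (solve (N ∷ q ∷ a ∷ b ∷ x ∷ y ∷ qa ∷ qb ∷ []))

    mostly : ∀ x e y → N ≤ x + (e + y) → 4 * e < N → 4 * y < N → N < 2 * x
    mostly x e y h₁ h₂ h₃ = ≰⇒> λ (h₄ : 2 * x ≤ N) → exceeds 1 (4 ⊛ h₁ ⊕ h₂ ⊕ h₃ ⊕ 2 ⊛ h₄)
      (solve (N ∷ x ∷ e ∷ y ∷ []))

    -- A vertex of `Ax?` sees none of `B′?`, so `b′` and `a′` are below N/4, which makes both `a`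
    -- and `b` larger than N/2.
    no-Ax : ∀ u → ¬ (bA u ≡ s × rA u ≢ k)
    no-Ax u x = both-big (mostly a aˣ a′ totalA few-Ax (≤-trans (s≤s (4 ⊛ a′≤b′)) b′-few))
                         (mostly b bˣ b′ totalB few-Bx b′-few)
      where
      b′-few : 4 * b′ < N
      b′-few = farA C u B′? λ w → Ax-far-B′ x

    module SmallB′ (small : 2 * b′ < N) where

      a-big : N < 2 * a
      a-big = arith a aˣ a′ b′ totalA (≤-reflexive (count-empty Ax? no-Ax)) a′≤b′ small
        where
        arith : ∀ a e a′ b′ → N ≤ a + (e + a′) → e ≤ 0 → a′ ≤ b′ → 2 * b′ < N → N < 2 * a
        arith a e a′ b′ h₁ h₂ h₃ h₄ = ≰⇒> λ (h₅ : 2 * a ≤ N) → exceeds 0 (2 ⊛ h₁ ⊕ 2 ⊛ h₂ ⊕ 2 ⊛ h₃ ⊕ h₄ ⊕ h₅)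
          (solve (N ∷ a ∷ e ∷ a′ ∷ b′ ∷ []))

      no-Bx : (∀ w → ¬ (bB w ≡ s × rB w ≢ R)) → ⊥
      no-Bx none = both-big a-big (arith b bˣ b′ totalB (≤-reflexive (count-empty Bx? none)) small)
        where
        arith : ∀ b e b′ → N ≤ b + (e + b′) → e ≤ 0 → 2 * b′ < N → N < 2 * b
        arith b e b′ h₁ h₂ h₃ = ≰⇒> λ (h₄ : 2 * b ≤ N) → exceeds 0 (2 ⊛ h₁ ⊕ 2 ⊛ h₂ ⊕ h₃ ⊕ h₄)
          (solve (N ∷ b ∷ e ∷ b′ ∷ []))

      module SomeBx (w* : Fin N) (w*∈ : bB w* ≡ s × rB w* ≢ R) where

        a′-few : 4 * a′ < N
        a′-few = farB C w* A′? λ u c → Bx-far-A′ c w*∈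

        a-huge : 3 * N < 4 * a
        a-huge = arith a aˣ a′ totalA (≤-reflexive (count-empty Ax? no-Ax)) a′-few
          where
          arith : ∀ a e a′ → N ≤ a + (e + a′) → e ≤ 0 → 4 * a′ < N → 3 * N < 4 * a
          arith a e a′ h₁ h₂ h₃ = ≰⇒> λ (h₄ : 4 * a ≤ 3 * N) → exceeds 0 (4 ⊛ h₁ ⊕ 4 ⊛ h₂ ⊕ h₃ ⊕ h₄)
            (solve (N ∷ a ∷ e ∷ a′ ∷ []))

        -- An uncovered `w` would see no uncovered vertex of `Ak?`, bounding `a` by N/4 + q, which
        -- is less than 3N/4.
        BR⊆Q : ∀ w → bB w ≡ s × rB w ≡ R → T (QB s w)
        BR⊆Q w (_ , r′) with T? (QB s w)
        ... | yes y = y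
        ... | no ¬y = ⊥-elim (arith a (count X?) qa qb (count-∪ Ak? X? (T? ∘ QA s) λ u → dec-remove (T? (QA s u)))
            (farB C w X? far) a-huge (sizeQ s) 2q<N)
          where
          X? = λ u → Ak? u ×-dec ¬? (T? (QA s u))
          far : ∀ u → (bA u ≡ s × rA u ≡ k) × ¬ T (QA s u) → T (adj u w) → ⊥
          far u ((c , r) , ¬x) e with edge e
          ... | inj₁ (f , _) = k≢R (trans (sym r) (trans f r′))
          ... | inj₂ (_ , h) = neither ¬x ¬y (h c)
          arith : ∀ a x qa qb → a ≤ x + qa → 4 * x < N → 3 * N < 4 * a → qa + qb ≤ q → 2 * q < N → ⊥
          arith a x qa qb h₁ h₂ h₃ h₄ h₅ = exceeds (3 + 4 * qb) (4 ⊛ h₁ ⊕ h₂ ⊕ h₃ ⊕ 4 ⊛ h₄ ⊕ 2 ⊛ h₅)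
            (solve (N ∷ q ∷ a ∷ x ∷ qa ∷ qb ∷ []))

        Ak-sealed : ∀ {u w} → bA u ≡ s × rA u ≡ k → ¬ T (PA k u) × ¬ T (QA s u) →
          ¬ T (PB k w) × ¬ T (QB s w) → T (adj u w) → ⊥
        Ak-sealed (c , r) (¬p , ¬q) (¬p′ , ¬q′) e with edge e
        ... | inj₁ (_ , h) = neither ¬p ¬p′ (h r)
        ... | inj₂ (_ , h) = neither ¬q ¬q′ (h c)

        -- By `no-Ax` the free left vertices of column `s` are in `Ak?`, where a free right vertex
        -- has no free neighbour. It sees only free vertices off column `s`.
        freeA-half : 4 * count (freeA? k s) < 2 * N
        freeA-half = half-bound (count (freeA? k s)) a′ (exceptB C (proj₁ w₁) (freeA? k s) A′? sees) a′-few
          where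
          w₁ = freeB-witness C k s
          sees : ∀ u → ¬ T (PA k u) × ¬ T (QA s u) → T (adj u (proj₁ w₁)) → bA u ≢ s
          sees u f e c = Ak-sealed (c , decidable-stable (rA u ≟ k) (λ r → no-Ax u (c , r))) f (proj₂ w₁) e

        Ak⊆P∪Q : ∀ u → bA u ≡ s × rA u ≡ k → T (PA k u) ⊎ T (QA s u)
        Ak⊆P∪Q u x with T? (PA k u) | T? (QA s u)
        ... | yes y | _     = inj₁ y
        ... | no _  | yes y = inj₂ y
        ... | no ¬p | no ¬q = ⊥-elim (arith (count (freeA? k s)) (count (freeB? k s)) (freeA+freeB C k s) freeA-half
            (farA C u (freeB? k s) λ w f → Ak-sealed x (¬p , ¬q) f))
          where
          arith : ∀ x y → N < x + y → 4 * x < 2 * N → 4 * y < N → ⊥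
          arith x y h₁ h₂ h₃ = exceeds (5 + N) (4 ⊛ h₁ ⊕ h₂ ⊕ h₃) (solve (N ∷ x ∷ y ∷ []))

        pa = count (T? ∘ PA k)
        pb = count (T? ∘ PB k)

        b≤qb : b ≤ qb
        b≤qb = count-mono BR? (T? ∘ QB s) BR⊆Q

        -- `u₀` sees nothing of `Y`. The covers `P k` and `Q s` then contain more than 3N/4 vertices
        -- on the left and, apart from `Bx?` and `Y`, everything on the right: in total more than N.
        uncovered-Ak : ∀ u₀ → bA u₀ ≡ s → rA u₀ ≡ k → ¬ T (PA k u₀) → ⊥
        uncovered-Ak u₀ c r ¬p = arith a b b′ bˣ (count Y?) pa pb qa qb
            (count-∪ Ak? (T? ∘ PA k) (T? ∘ QA s) Ak⊆P∪Q)
            (count-∪ B′? Y? (T? ∘ PB k) λ w → dec-remove (T? (PB k w))) b≤qb totalB few-Bx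
            (farA C u₀ Y? far) a-huge (sizeP k) (sizeQ s) p+q<N
          where
          Y? = λ w → B′? w ×-dec ¬? (T? (PB k w))
          far : ∀ w → bB w ≢ s × ¬ T (PB k w) → T (adj u₀ w) → ⊥
          far w (c′ , ¬p′) e with edge e
          ... | inj₁ (_ , h) = neither ¬p ¬p′ (h r)
          ... | inj₂ (f , _) = c′ (trans (sym f) c)
          arith : ∀ a b b′ e y pa pb qa qb → a ≤ pa + qa → b′ ≤ y + pb → b ≤ qb → N ≤ b + (e + b′) →
            4 * e < N → 4 * y < N → 3 * N < 4 * a → pa + pb ≤ p → qa + qb ≤ q → p + q < N → ⊥
          arith a b b′ e y pa pb qa qb h₁ h₂ h₃ h₄ h₅ h₆ h₇ h₈ h₉ h₁₀ =
            exceeds (6 + N) (4 ⊛ h₁ ⊕ 4 ⊛ h₂ ⊕ 4 ⊛ h₃ ⊕ 4 ⊛ h₄ ⊕ h₅ ⊕ h₆ ⊕ h₇ ⊕ 4 ⊛ h₈ ⊕ 4 ⊛ h₉ ⊕ 4 ⊛ h₁₀)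
              (solve (N ∷ p ∷ q ∷ a ∷ b ∷ b′ ∷ e ∷ y ∷ pa ∷ pb ∷ qa ∷ qb ∷ []))

        -- Now `P k` alone has more than 3N/4 left vertices, and `Q s` has at least `b` right
        -- vertices, more than N/4 because `b′` is below N/2.
        Ak-in-P : (∀ u → bA u ≡ s × rA u ≡ k → T (PA k u)) → ⊥
        Ak-in-P inP = arith a b b′ bˣ pa pb qa qb (count-mono Ak? (T? ∘ PA k) inP) b≤qb totalB few-Bx small
            a-huge (sizeP k) (sizeQ s) p+q<N
          where
          arith : ∀ a b b′ e pa pb qa qb → a ≤ pa → b ≤ qb → N ≤ b + (e + b′) → 4 * e < N → 2 * b′ < N →
            3 * N < 4 * a → pa + pb ≤ p → qa + qb ≤ q → p + q < N → ⊥
          arith a b b′ e pa pb qa qb h₁ h₂ h₃ h₄ h₅ h₆ h₇ h₈ h₉ =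
            exceeds (7 + 4 * pb + 4 * qa) (4 ⊛ h₁ ⊕ 4 ⊛ h₂ ⊕ 4 ⊛ h₃ ⊕ h₄ ⊕ 2 ⊛ h₅ ⊕ h₆ ⊕ 4 ⊛ h₇ ⊕ 4 ⊛ h₈ ⊕ 4 ⊛ h₉)
              (solve (N ∷ p ∷ q ∷ a ∷ b ∷ b′ ∷ e ∷ pa ∷ pb ∷ qa ∷ qb ∷ []))

        impossible : ⊥
        impossible with search (λ u → Ak? u ×-dec ¬? (T? (PA k u)))
        ... | inj₁ (u₀ , (c , r) , ¬p) = uncovered-Ak u₀ c r ¬p
        ... | inj₂ none = Ak-in-P λ u x → decidable-stable (T? (PA k u)) λ ¬x → none u (x , ¬x)

      impossible : ⊥
      impossible with search Bx?
      ... | inj₁ (w* , w*∈) = SomeBx.impossible w* w*∈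
      ... | inj₂ none       = no-Bx none

    b′-big : N ≤ 2 * b′
    b′-big = ≮⇒≥ SmallB′.impossible

    -- Off column `s` the rows `R` and `k` differ, so edges there need a common column, and no
    -- vertex of `B′?` can be in the columns of both `u` and `v` if these differ.
    A′-one-col : ∀ u v → bA u ≢ s → bA v ≢ s → bA u ≡ bA v
    A′-one-col u v u∈ v∈ with bA u ≟ bA v
    ... | yes e = e
    ... | no ¬e = ⊥-elim (arith b′ (count (Z? u)) (count (Z? v))
        (count-∪ B′? (Z? u) (Z? v) split) (farA C u (Z? u) (farZ u u∈)) (farA C v (Z? v) (farZ v v∈)) b′-big)
      where
      Z? = λ z w → ¬? (bB w ≟ s) ×-dec ¬? (bA z ≟ bB w)
      split : ∀ w → bB w ≢ s → (bB w ≢ s × bA u ≢ bB w) ⊎ (bB w ≢ s × bA v ≢ bB w)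
      split w r with bA u ≟ bB w
      ... | no x  = inj₁ (r , x)
      ... | yes x = inj₂ (r , λ y → ¬e (trans x (sym y)))
      farZ : ∀ z → bA z ≢ s → ∀ w → bB w ≢ s × bA z ≢ bB w → T (adj z w) → ⊥
      farZ z z∈ w (r , x) e with edge e
      ... | inj₁ (f , _) = k≢R (trans (sym (rowB r)) (trans (sym f) (rowA z∈)))
      ... | inj₂ (f , _) = x f
      arith : ∀ b x y → b ≤ x + y → 4 * x < N → 4 * y < N → N ≤ 2 * b → ⊥
      arith b x y h₁ h₂ h₃ h₄ = exceeds 1 (4 ⊛ h₁ ⊕ h₂ ⊕ h₃ ⊕ 2 ⊛ h₄) (solve (N ∷ b ∷ x ∷ y ∷ []))

    -- The left vertices outside the column s form a single column, so the row k is shared.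
    impossible : ⊥
    impossible = shared-row C 2q<N {k} {bA u′} {s} u′∈ on (u′ , λ e → k≢R (trans (sym e) (rowA u′∈)))
        onB (proj₁ atB , λ e → k≢R (trans (sym e) (proj₁ (proj₂ atB))))
      where
      u′ = proj₁ offA
      u′∈ = proj₂ offA
      on : ∀ u → rA u ≡ k ⊎ bA u ≡ bA u′
      on u with bA u ≟ s
      ... | yes c = inj₁ (decidable-stable (rA u ≟ k) λ r → no-Ax u (c , r))
      ... | no c  = inj₂ (A′-one-col u u′ c u′∈)

  -- Exchanging the colours does not reduce this to `shared-row`, since `2 * q < N` would become a
  -- bound on `p`.
  shared-col : ∀ {N p q} (C : Config N p q) → 2 * q < N → ∀ {R k s} → k ≢ R → let open Config C in
    Cross rA bA rB bB R s → Cross rB bB rA bA k s → ⊥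
  shared-col C 2q<N {s = s} k≢R X Y
    with ≤-total (count (λ u → ¬? (Config.bA C u ≟ s))) (count (λ w → ¬? (Config.bB C w ≟ s)))
  ... | inj₁ a′≤b′ = SharedCol.impossible C 2q<N k≢R (on X) (offᵇ X) (on Y) (offᵇ Y) (at X) a′≤b′
    where open Cross
  ... | inj₂ b′≤a′ = SharedCol.impossible (flip C) 2q<N (λ e → k≢R (sym e)) (on Y) (offᵇ Y) (on X) (offᵇ X) (at Y) b′≤a′
    where open Cross

  no-config : ∀ {N p q} → Config N p q → 2 * q < N → ⊥
  no-config C 2q<N with find-cross C | find-cross (flip C)
  ... | R , s , X | k , l , Y with k ≟ R | l ≟ s
  ...   | yes refl | yes refl = same-cross C X Y
  ...   | yes refl | no l≢s = shared-row C 2q<N (λ e → l≢s (sym e)) (on X) (offʳ X) (on Y) (offʳ Y)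
    where open Cross
  ...   | no k≢R | yes refl = shared-col C 2q<N k≢R X Y
  -- The left vertex in the cell (k, l) must lie on the cross (R, s), so the two crosses share a row
  -- or a column.
  ...   | no k≢R | no l≢s with Cross.at Y
  ...     | u , r , c = [ (λ e → k≢R (trans (sym r) e)) , (λ e → l≢s (trans (sym c) e)) ]′ (Cross.on X u)

-- Components of the coloured graph

_≟ᵛ_ : ∀ {N} → DecidableEquality (Vertex N)
_≟ᵛ_ = ⊎-≡-dec _≟ᶠ_ _≟ᶠ_

_≟ᶜ_ : DecidableEquality Colour
red  ≟ᶜ red  = yes refl
red  ≟ᶜ blue = no λ ()
blue ≟ᶜ red  = no λ ()
blue ≟ᶜ blue = yes refl

module Coloured {N} (G : BipGraph N) (χ : Colouring N) (c : Colour) where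

  edge? : ∀ i j → Dec (ColEdge G χ c i j)
  edge? i j = T? (G i j) ×-dec (χ i j ≟ᶜ c)

  Reach-trans : ∀ {u v w} → Reach G χ c u v → Reach G χ c v w → Reach G χ c u w
  Reach-trans here        q = q
  Reach-trans (stepʳ e p) q = stepʳ e (Reach-trans p q)
  Reach-trans (stepˡ e p) q = stepˡ e (Reach-trans p q)

  Reach-sym : ∀ {u v} → Reach G χ c u v → Reach G χ c v u
  Reach-sym here        = here
  Reach-sym (stepʳ e p) = Reach-trans (Reach-sym p) (stepˡ e here)
  Reach-sym (stepˡ e p) = Reach-trans (Reach-sym p) (stepʳ e here)

  -- Components are found by adding edges one at a time: `complete` concerns only the pairs listed
  -- so far, `sound` reachability in the whole graph.
  record Labelling (es : List (Fin N × Fin N)) : Set where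
    field
      label    : Vertex N → Vertex N
      sound    : ∀ u v → label u ≡ label v → Reach G χ c u v
      complete : ∀ {i j} → (i , j) ∈ es → ColEdge G χ c i j → label (inj₁ i) ≡ label (inj₂ j)

  merge : ∀ {i j es} → ColEdge G χ c i j → Labelling es → Labelling ((i , j) ∷ es)
  merge {i} {j} {es} e Λ = record { label = label′ ; sound = sound′ ; complete = complete′ }
    where
    open Labelling Λ
    x = inj₁ i
    y = inj₂ j
    label′ : Vertex N → Vertex N
    label′ v with label v ≟ᵛ label x
    ... | yes _ = label y
    ... | no _  = label v
    sound′ : ∀ u v → label′ u ≡ label′ v → Reach G χ c u v
    sound′ u v h with label u ≟ᵛ label x | label v ≟ᵛ label x
    ... | yes p | yes q = sound u v (trans p (sym q))
    ... | yes p | no _  = Reach-trans (sound u x p) (stepʳ e (sound y v h))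
    ... | no _  | yes q = Reach-trans (sound u y h) (stepˡ e (sound x v (sym q)))
    ... | no _  | no _  = sound u v h
    cong′ : ∀ u v → label u ≡ label v → label′ u ≡ label′ v
    cong′ u v h with label u ≟ᵛ label x | label v ≟ᵛ label x
    ... | yes _ | yes _ = refl
    ... | yes p | no ¬q = ⊥-elim (¬q (trans (sym h) p))
    ... | no ¬p | yes q = ⊥-elim (¬p (trans h q))
    ... | no _  | no _  = h
    joined : label′ x ≡ label′ y
    joined with label x ≟ᵛ label x | label y ≟ᵛ label x
    ... | yes _ | yes _ = refl
    ... | yes _ | no _  = refl
    ... | no ¬p | _     = ⊥-elim (¬p refl)
    complete′ : ∀ {k l} → (k , l) ∈ (i , j) ∷ es → ColEdge G χ c k l → label′ (inj₁ k) ≡ label′ (inj₂ l)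
    complete′ (here refl) _ = joined
    complete′ (there m)   f = cong′ _ _ (complete m f)

  labelling : ∀ es → Labelling es
  labelling [] = record { label = id ; sound = λ { _ _ refl → here } ; complete = λ () }
  labelling ((i , j) ∷ es) with edge? i j
  ... | yes e = merge e (labelling es)
  ... | no ¬e = record { label = label ; sound = sound
                       ; complete = λ { (here refl) e → ⊥-elim (¬e e) ; (there m) e → complete m e } }
    where open Labelling (labelling es)

  open Labelling (labelling (cartesianProduct (allFin N) (allFin N))) public using (label; sound)

  label-edge : ∀ {i j} → ColEdge G χ c i j → label (inj₁ i) ≡ label (inj₂ j)
  label-edge {i} {j} = Labelling.complete (labelling (cartesianProduct (allFin N) (allFin N)))
    (∈-cartesianProduct⁺ (∈-allFin i) (∈-allFin j))

  InComponent : Vertex N → Fin N → Fin N → Set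
  InComponent ℓ i j = ColEdge G χ c i j × label (inj₁ i) ≡ ℓ

  connect : ∀ {ℓ k} → Matching (InComponent ℓ) k → ConnMatching G χ c k
  connect μ = record
    { left = left ; right = right ; edges = λ t → proj₁ (edges t)
    ; left-inj = left-inj ; right-inj = right-inj
    ; connected = λ s t → sound _ _ (trans (proj₂ (edges s)) (sym (proj₂ (edges t)))) }
    where open Matching μ

  -- Labels are vertices, so a choice over all components is a finite choice on each side.
  matching-or-covers : ∀ k → ConnMatching G χ c k ⊎ (∀ ℓ → Cover (InComponent ℓ) k)
  matching-or-covers k with ⊎-∀ (decide ∘ inj₁) | ⊎-∀ (decide ∘ inj₂)
    where
    decide : ∀ ℓ → ConnMatching G χ c k ⊎ Cover (InComponent ℓ) k
    decide ℓ = ⊎-map connect id (könig (InComponent ℓ) (λ i j → edge? i j ×-dec (label (inj₁ i) ≟ᵛ ℓ)) k)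
  ... | inj₁ μ | _      = inj₁ μ
  ... | inj₂ _ | inj₁ μ = inj₁ μ
  ... | inj₂ f | inj₂ g = inj₂ λ { (inj₁ i) → f i ; (inj₂ j) → g j }

-- From the coloured graph to a configuration

few-non-neighbours : ∀ {N} (f : Fin N → Bool) →
  3 * N < 4 * length (filter (λ i → T? (f i)) (allFin N)) → 4 * count (λ i → ¬? (T? (f i))) < N
few-non-neighbours {N} f h = arith (count (T? ∘ f)) (count (λ i → ¬? (T? (f i))))
  (subst (λ d → 3 * N < 4 * d) (length-filter-tabulate (T? ∘ f) id) h)
  (≤-trans (count-⊎ (all-of N) (T? ∘ f) (λ i → ¬? (T? (f i))) _ _ (λ i x ¬x → ¬x x))
    (≤-reflexive (count-full (all-of N) _)))
  where
  arith : ∀ x y → 3 * N < 4 * x → x + y ≤ N → 4 * y < N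
  arith x y h₁ h₂ = ≰⇒> λ (h₃ : N ≤ 4 * y) → exceeds 0 (h₁ ⊕ 4 ⊛ h₂ ⊕ h₃) (solve (N ∷ x ∷ y ∷ []))

coloured-config : ∀ {N p q} (G : BipGraph N) → MinDegGT3/4 G → (χ : Colouring N) → p + q < N →
  (∀ ℓ → Cover (Coloured.InComponent G χ red ℓ) (suc p)) →
  (∀ ℓ → Cover (Coloured.InComponent G χ blue ℓ) (suc q)) →
  Configurations.Config _≟ᵛ_ N p q
coloured-config G δ χ p+q<N P Q = record
  { adj = G
  ; rA = Red.label ∘ inj₁ ; rB = Red.label ∘ inj₂ ; bA = Blue.label ∘ inj₁ ; bB = Blue.label ∘ inj₂
  ; PA = λ ℓ → Cover.inˡ (P ℓ) ; PB = λ ℓ → Cover.inʳ (P ℓ)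
  ; QA = λ ℓ → Cover.inˡ (Q ℓ) ; QB = λ ℓ → Cover.inʳ (Q ℓ)
  ; edge = λ {u} {w} → link u w
  ; sizeP = λ ℓ → ≤-pred (Cover.size (P ℓ)) ; sizeQ = λ ℓ → ≤-pred (Cover.size (Q ℓ))
  ; p+q<N = p+q<N
  ; degA = λ u → few-non-neighbours (G u) (δ (inj₁ u))
  ; degB = λ w → few-non-neighbours (λ u → G u w) (δ (inj₂ w)) }
  where
  module Red  = Coloured G χ red
  module Blue = Coloured G χ blue
  open Configurations _≟ᵛ_ using (Hit)
  link : ∀ u w → T (G u w) →
    Hit (Red.label (inj₁ u)) (Red.label (inj₂ w)) (λ ℓ → Cover.inˡ (P ℓ) u) (λ ℓ → Cover.inʳ (P ℓ) w) ⊎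
    Hit (Blue.label (inj₁ u)) (Blue.label (inj₂ w)) (λ ℓ → Cover.inˡ (Q ℓ) u) (λ ℓ → Cover.inʳ (Q ℓ) w)
  link u w e with χ u w in eq
  ... | red  = inj₁ (Red.label-edge (e , eq) , λ {ℓ} h → Cover.covers (P ℓ) ((e , eq) , h))
  ... | blue = inj₂ (Blue.label-edge (e , eq) , λ {ℓ} h → Cover.covers (Q ℓ) ((e , eq) , h))

theorem1p5 : (m n : ℕ) → 0 < n → n < m →
    (G : BipGraph (m + n ∸ 1)) → MinDegGT3/4 G →
    (χ : Colouring (m + n ∸ 1)) →
    ConnMatching G χ red m ⊎ ConnMatching G χ blue n
theorem1p5 (suc p) (suc q) _ (s≤s q<p) G δ χ
  with Coloured.matching-or-covers G χ red (suc p) | Coloured.matching-or-covers G χ blue (suc q)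
... | inj₁ μ | _      = inj₁ μ
... | inj₂ _ | inj₁ μ = inj₂ μ
... | inj₂ P | inj₂ Q = ⊥-elim (Configurations.no-config _≟ᵛ_ config 2q<N)
  where
  config : Configurations.Config _≟ᵛ_ (p + suc q) p q
  config = coloured-config G δ χ (≤-reflexive (sym (+-suc p q))) P Q
  2q<N : 2 * q < p + suc q
  -- Here m = p + 1, n = q + 1 and N = p + q + 1, so `n < m` enters as `q < p`.
  2q<N = ≰⇒> λ (h : p + suc q ≤ 2 * q) → exceeds 1 (q<p ⊕ h) (solve (p ∷ q ∷ []))
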